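{- Let $G$ be a (simple) graph with maximum degree $\Delta\leq 4$. Then $\kappa_E(G,\Delta+2)=1$, i.e., any two $(\Delta+2)$-edge-colourings of $G$ are Kempe equivalent.
   Context: A $k$-edge-colouring of a graph $G$ is an assignment of colours from $\{1,\ldots,k\}$ to the edges of $G$ such that adjacent edges (edges sharing an endpoint) receive different colours. Given a $k$-edge-colouring and two colours $a,b$, the edges coloured $a$ or $b$ form a subgraph whose components are paths and cycles alternating in $a$ and $b$; a Kempe change is the operation of interchanging $a$ and $b$ on one such connected component (a maximal $(a,b)$-alternating path or an $(a,b)$-alternating cycle), which yields another $k$-edge-colouring. Two $k$-edge-colourings are Kempe equivalent if one can be obtained from the other by a sequence of Kempe changes; colourings differing only by a permutation of the colours are regarded as the same colouring. $\kappa_E(G,k)$ denotes the number of Kempe equivalence classes of $k$-edge-colourings of $G$. -}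

module Defs where

open import Data.Nat using (ℕ; _⊔_)
open import Data.Bool using (Bool; true; false; if_then_else_)
open import Data.Fin using (Fin; _≟_)
open import Data.List using (List; map; foldr; allFin)
open import Data.Nat.ListAction using (sum)
open import Data.Product using (Σ; ∃; _×_; _,_)
open import Data.Sum using (_⊎_)
open import Relation.Nullary using (¬_; yes; no)
open import Relation.Binary.PropositionalEquality using (_≡_; _≢_)
open import Relation.Binary.Construct.Closure.ReflexiveTransitive using (Star)
open import Data.Fin.Permutation using (Permutation′; _⟨$⟩ʳ_)

record Graph (n : ℕ) : Set where
  field
    adj   : Fin n → Fin n → Bool
    sym   : ∀ u v → adj u v ≡ adj v u
    irrefl : ∀ u → adj u u ≡ false
open Graph public

Adj : ∀ {n} → Graph n → Fin n → Fin n → Set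
Adj G u v = adj G u v ≡ true

degree : ∀ {n} → Graph n → Fin n → ℕ
degree {n} G u = sum (map (λ v → if adj G u v then 1 else 0) (allFin n))

maxDegree : ∀ {n} → Graph n → ℕ
maxDegree {n} G = foldr _⊔_ 0 (map (degree G) (allFin n))

-- A colour assignment: c u v is the colour of the edge uv (values on
-- non-edges are irrelevant).
Assignment : ℕ → ℕ → Set
Assignment n k = Fin n → Fin n → Fin k

record IsEdgeColouring {n} (G : Graph n) (k : ℕ) (c : Assignment n k) : Set where
  field
    symmetric : ∀ u v → Adj G u v → c u v ≡ c v u
    proper    : ∀ u v w → Adj G u v → Adj G u w → v ≢ w → c u v ≢ c u w
open IsEdgeColouring public

swap : ∀ {k} → Fin k → Fin k → Fin k → Fin k
swap a b x with x ≟ a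
... | yes _ = b
... | no _ with x ≟ b
...   | yes _ = a
...   | no _ = x

-- Edges (as oriented pairs) of the (a,b)-subgraph of c reachable from the
-- edge u₀v₀: i.e. the (a,b)-component (alternating path/cycle) containing u₀v₀.
data InComponent {n k} (G : Graph n) (c : Assignment n k) (a b : Fin k)
                 (u₀ v₀ : Fin n) : Fin n → Fin n → Set where
  base : InComponent G c a b u₀ v₀ u₀ v₀
  flip : ∀ {u v} → InComponent G c a b u₀ v₀ u v → InComponent G c a b u₀ v₀ v u
  step : ∀ {u v w} → InComponent G c a b u₀ v₀ u v → Adj G v w →
         (c v w ≡ a ⊎ c v w ≡ b) → InComponent G c a b u₀ v₀ v w

KempeChange : ∀ {n k} → Graph n → Assignment n k → Assignment n k → Set
KempeChange {n} {k} G c d =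
  Σ (Fin k) λ a → Σ (Fin k) λ b → a ≢ b × Σ (Fin n) λ u₀ → Σ (Fin n) λ v₀ →
    Adj G u₀ v₀ × (c u₀ v₀ ≡ a ⊎ c u₀ v₀ ≡ b) ×
    (∀ u v → Adj G u v →
       (InComponent G c a b u₀ v₀ u v → d u v ≡ swap a b (c u v)) ×
       (¬ InComponent G c a b u₀ v₀ u v → d u v ≡ c u v))

-- Kempe equivalence, with colourings identified up to a permutation of colours
-- (and up to their values on edges).
KempeEquivalent : ∀ {n k} → Graph n → Assignment n k → Assignment n k → Set
KempeEquivalent {n} {k} G c c′ =
  Σ (Permutation′ k) λ π → ∃ λ d →
    Star (KempeChange G) c d × (∀ u v → Adj G u v → d u v ≡ π ⟨$⟩ʳ c′ u v)

-- Vertices are put back one at a time, so it suffices to lift Kempe equivalence from H = G − u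
-- to G. A colouring c of H leaves at least three free colours at each of the at most four
-- neighbours of u, and its extensions are the systems of distinct representatives of these sets
-- of free colours. All extensions of one c are equivalent, and a Kempe change of H lifts whenever
-- both colourings of H extend. A colouring does not extend only when u has degree four and all
-- neighbours have the same three free colours I. Then interchanging a colour i in I with a colour
-- j outside I along a path that ends at some but not all neighbours makes it extendable; two such
-- exits in disjoint pairs of colours commute, as do an exit and a Kempe change in two other
-- colours. As there are three choices for i and for j, all exits lead to the same class, and a
-- sequence of Kempe changes of H can be followed through colourings that do not extend.
module Submission where

open import Defs
open import Data.Bool using (Bool; true; false; if_then_else_; _∧_; not)
import Data.Bool.Properties as Bool
open import Data.Fin using (Fin; zero; suc; _≟_)
open import Data.Fin.Properties using (any?; all?; injective⇒≤)
open import Data.Fin.Permutation using () renaming (id to identity)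
open import Data.List using (List; []; _∷_; map; filter; length; lookup; allFin; foldr)
open import Data.List.Membership.Propositional using (_∈_; _∉_)
open import Data.List.Membership.Propositional.Properties using (∈-allFin; ∈-filter⁺; ∈-filter⁻; ∈-map⁺; ∈-lookup)
import Data.List.Membership.DecPropositional as DecMembership
open import Data.List.Relation.Unary.All using (All; []; _∷_)
import Data.List.Relation.Unary.All as All
open import Data.List.Properties using (length-map; length-tabulate)
open import Data.List.Relation.Unary.AllPairs using ([]; _∷_)
open import Data.List.Relation.Unary.Any using (here; there; index)
open import Data.List.Relation.Unary.Any.Properties using (lookup-index)
open import Data.List.Relation.Unary.Unique.Propositional using (Unique)
open import Data.List.Relation.Unary.Unique.Propositional.Properties using (filter⁺; allFin⁺)
open import Data.Nat using (ℕ; suc; _+_; _≤_; _<_; z≤n; s≤s; _⊔_)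
import Data.Nat.Properties as ℕ
open import Data.Nat.ListAction using (sum)
open import Data.Product using (∃-syntax; _×_; _,_; proj₁; proj₂)
open import Data.Sum using (_⊎_; inj₁; inj₂; [_,_])
open import Data.Empty using (⊥; ⊥-elim)
open import Function using (_∘_)
open import Function.Bundles using (mk⇔)
open import Relation.Nullary using (¬_; Dec; yes; no; does; contradiction)
open import Relation.Nullary.Decidable using (_×-dec_; _⊎-dec_; _→-dec_; ¬?; dec-true; dec-false; does-⇔; decidable-stable)
open import Relation.Binary using (Rel; Decidable)
open import Relation.Binary.PropositionalEquality using (_≡_; _≢_; refl; trans; cong; cong₂; subst; ≢-sym) renaming (sym to ≡-sym)
open import Relation.Binary.Construct.Closure.ReflexiveTransitive using (Star; ε; _◅_; _◅◅_)
open import Level using (0ℓ)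

-- An interchange on `G − u` need not be one on `G`, since `u` may merge components that are
-- separate in `G − u`. This does harm only if edges at `u` in both colours lead to opposite sides
-- of the set that is interchanged. The extension is then changed beforehand, and a configuration
-- that resists every such change would leave the four neighbours only three colours after the
-- interchange. A colour that is free at one neighbour of `u` and not at another certifies that a
-- colouring extends. Interchanges in two other colours keep this certificate, which is why exits
-- commute with them. Three choices on each side are just enough: two exits are compared through a
-- third one whose colours differ from those of both, and before a switch in colours a and b is
-- followed, the exit is replaced by one that avoids a and b. On one side the three come from Δ + 2
-- - (Δ - 1), on the other from Δ = 4, hence six colours.

private
  variable
    n k : ℕ

-- Preliminaries: transpositions of colours, finite reachability, counting

swap-first : (a b : Fin k) → swap a b a ≡ b
swap-first a b with a ≟ a
... | yes _ = refl
... | no a≢a = contradiction refl a≢a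

swap-second : (a b : Fin k) → swap a b b ≡ a
swap-second a b with b ≟ a
... | yes b≡a = b≡a
... | no _ with b ≟ b
...   | yes _ = refl
...   | no b≢b = contradiction refl b≢b

swap-other : {a b x : Fin k} → x ≢ a → x ≢ b → swap a b x ≡ x
swap-other {a = a} {b} {x} x≢a x≢b with x ≟ a
... | yes x≡a = contradiction x≡a x≢a
... | no _ with x ≟ b
...   | yes x≡b = contradiction x≡b x≢b
...   | no _ = refl

data SwapView (a b x : Fin k) : Set where
  first  : x ≡ a → swap a b x ≡ b → SwapView a b x
  second : x ≡ b → swap a b x ≡ a → SwapView a b x
  other  : x ≢ a → x ≢ b → swap a b x ≡ x → SwapView a b x

swapView : (a b x : Fin k) → SwapView a b x
swapView a b x with x ≟ a
... | yes refl = first refl (swap-first a b)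
... | no x≢a with x ≟ b
...   | yes refl = second refl (swap-second a b)
...   | no x≢b = other x≢a x≢b (swap-other x≢a x≢b)

swap-involutive : (a b x : Fin k) → swap a b (swap a b x) ≡ x
swap-involutive a b x with swapView a b x
... | first refl e = trans (cong (swap a b) e) (swap-second a b)
... | second refl e = trans (cong (swap a b) e) (swap-first a b)
... | other _ _ e = trans (cong (swap a b) e) e

swap-injective : (a b : Fin k) {x y : Fin k} → swap a b x ≡ swap a b y → x ≡ y
swap-injective a b {x} {y} e =
  trans (≡-sym (swap-involutive a b x)) (trans (cong (swap a b) e) (swap-involutive a b y))

swap-comm : (a b x : Fin k) → swap a b x ≡ swap b a x
swap-comm a b x with swapView a b x
... | first refl e = trans e (≡-sym (swap-second b a))
... | second refl e = trans e (≡-sym (swap-first b a))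
... | other x≢a x≢b e = trans e (≡-sym (swap-other x≢b x≢a))

swap-same : (a x : Fin k) → swap a a x ≡ x
swap-same a x with swapView a a x
... | first refl e = e
... | second refl e = e
... | other _ _ e = e

swap-swap : {a b i j : Fin k} → i ≢ a → i ≢ b → j ≢ a → j ≢ b → ∀ x →
  swap a b (swap i j x) ≡ swap i j (swap a b x)
swap-swap {a = a} {b} {i} {j} i≢a i≢b j≢a j≢b x with swapView i j x
... | first refl e =
  trans (cong (swap a b) e) (trans (swap-other j≢a j≢b)
    (≡-sym (trans (cong (swap i j) (swap-other i≢a i≢b)) e)))
... | second refl e =
  trans (cong (swap a b) e) (trans (swap-other i≢a i≢b)
    (≡-sym (trans (cong (swap i j) (swap-other j≢a j≢b)) e)))
... | other x≢i x≢j e = trans (cong (swap a b) e) (≡-sym (swap-other p q))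
  where
    p : swap a b x ≢ i
    p s = x≢i (swap-injective a b (trans s (≡-sym (swap-other i≢a i≢b))))
    q : swap a b x ≢ j
    q s = x≢j (swap-injective a b (trans s (≡-sym (swap-other j≢a j≢b))))

OneOf : Fin k → Fin k → Fin k → Set
OneOf a b x = x ≡ a ⊎ x ≡ b

oneOf? : (a b x : Fin k) → Dec (OneOf a b x)
oneOf? a b x = (x ≟ a) ⊎-dec (x ≟ b)

swap-avoids : {a b x : Fin k} → ¬ OneOf a b x → swap a b x ≡ x
swap-avoids p = swap-other (p ∘ inj₁) (p ∘ inj₂)

swap-oneOf : {a b x : Fin k} → OneOf a b x → OneOf a b (swap a b x)
swap-oneOf {a = a} {b} (inj₁ refl) = inj₂ (swap-first a b)
swap-oneOf {a = a} {b} (inj₂ refl) = inj₁ (swap-second a b)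

swap-oneOf⁻ : {a b x : Fin k} → OneOf a b (swap a b x) → OneOf a b x
swap-oneOf⁻ {a = a} {b} {x} p = subst (OneOf a b) (swap-involutive a b x) (swap-oneOf p)

-- Kleene's algorithm: Via vs allows only vs as inner vertices.
module Reachability {R : Rel (Fin n) 0ℓ} (R? : Decidable R) where

  Via : List (Fin n) → Fin n → Fin n → Set
  Via [] x y = x ≡ y ⊎ R x y
  Via (v ∷ vs) x y = Via vs x y ⊎ (Via vs x v × Via vs v y)

  via? : ∀ vs x y → Dec (Via vs x y)
  via? [] x y = (x ≟ y) ⊎-dec R? x y
  via? (v ∷ vs) x y = via? vs x y ⊎-dec (via? vs x v ×-dec via? vs v y)

  via-sound : ∀ vs {x y} → Via vs x y → Star R x y
  via-sound [] (inj₁ refl) = ε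
  via-sound [] (inj₂ r) = r ◅ ε
  via-sound (v ∷ vs) (inj₁ p) = via-sound vs p
  via-sound (v ∷ vs) (inj₂ (p , q)) = via-sound vs p ◅◅ via-sound vs q

  via-base : ∀ vs {x y} → x ≡ y ⊎ R x y → Via vs x y
  via-base [] p = p
  via-base (v ∷ vs) p = inj₁ (via-base vs p)

  -- If `v` is the head of the list, whatever the first path does after reaching `v` and the second
  -- before finally leaving it is discarded. A deeper `v` concerns only the two pieces that meet
  -- there.
  via-trans : ∀ {vs v x y} → v ∈ vs → Via vs x v → Via vs v y → Via vs x y
  via-trans {v ∷ vs} (here refl) p q = inj₂ ([ (λ r → r) , proj₁ ] p , [ (λ r → r) , proj₂ ] q)
  via-trans (there v∈) (inj₁ p) (inj₁ q) = inj₁ (via-trans v∈ p q)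
  via-trans (there v∈) (inj₁ p) (inj₂ (q , q′)) = inj₂ (via-trans v∈ p q , q′)
  via-trans (there v∈) (inj₂ (p , p′)) (inj₁ q) = inj₂ (p , via-trans v∈ p′ q)
  via-trans (there v∈) (inj₂ (p , p′)) (inj₂ (q , q′)) = inj₂ (p , q′)

  via-complete : ∀ {x y} → Star R x y → Via (allFin n) x y
  via-complete ε = via-base (allFin n) (inj₁ refl)
  via-complete (_◅_ {j = v} r rs) =
    via-trans (∈-allFin v) (via-base (allFin n) (inj₂ r)) (via-complete rs)

  star? : ∀ x y → Dec (Star R x y)
  star? x y with via? (allFin n) x y
  ... | yes p = yes (via-sound (allFin n) p)
  ... | no ¬p = no (¬p ∘ via-complete)

unique-subset-length : {A : Set} {xs ys : List A} → Unique xs → (∀ {x} → x ∈ xs → x ∈ ys) →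
  length xs ≤ length ys
unique-subset-length {xs = xs} {ys} u xs⊆ys = injective⇒≤ {f = f} f-injective
  where
    f : Fin (length xs) → Fin (length ys)
    f i = index (xs⊆ys (∈-lookup i))
    lookup-injective : ∀ {zs : List _} → Unique zs → ∀ i j → lookup zs i ≡ lookup zs j → i ≡ j
    lookup-injective (_ ∷ _) zero zero _ = refl
    lookup-injective (z∉ ∷ _) zero (suc j) e = contradiction e (All.lookup z∉ (∈-lookup j))
    lookup-injective (z∉ ∷ _) (suc i) zero e = contradiction (≡-sym e) (All.lookup z∉ (∈-lookup i))
    lookup-injective (_ ∷ u) (suc i) (suc j) e = cong suc (lookup-injective u i j e)
    f-injective : ∀ {i j} → f i ≡ f j → i ≡ j
    f-injective {i} {j} e = lookup-injective u i j
      (trans (lookup-index (xs⊆ys (∈-lookup i)))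
        (trans (cong (lookup ys) e) (≡-sym (lookup-index (xs⊆ys (∈-lookup j))))))

absent-colour : (xs : List (Fin k)) → length xs < k → ∃[ t ] t ∉ xs
absent-colour {k} xs len with any? (λ t → ¬? (t ∈? xs))
  where open DecMembership _≟_ using (_∈?_)
... | yes p = p
... | no ¬p = contradiction (subst (_≤ length xs) length-allFin
    (unique-subset-length (allFin⁺ k) (λ {x} _ → all x))) (ℕ.<⇒≱ len)
  where
    open DecMembership _≟_ using (_∈?_)
    length-allFin = length-tabulate {n = k} (λ x → x)
    all : ∀ x → x ∈ xs
    all x = decidable-stable (x ∈? xs) (λ q → ¬p (x , q))

-- Colourings compared on edges only

Agree : Graph n → Assignment n k → Assignment n k → Set
Agree G c d = ∀ x y → Adj G x y → c x y ≡ d x y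

agree-sym : (G : Graph n) {c d : Assignment n k} → Agree G c d → Agree G d c
agree-sym G p x y e = ≡-sym (p x y e)

agree-trans : (G : Graph n) {c d e : Assignment n k} → Agree G c d → Agree G d e → Agree G c e
agree-trans G p q x y e = trans (p x y e) (q x y e)

adj-sym : (G : Graph n) {x y : Fin n} → Adj G x y → Adj G y x
adj-sym G {x} {y} e = trans (sym G y x) e

adj? : (G : Graph n) (x y : Fin n) → Dec (Adj G x y)
adj? G x y = adj G x y Bool.≟ true

adj⇒≢ : (G : Graph n) {x y : Fin n} → Adj G x y → x ≢ y
adj⇒≢ G {x} e refl with trans (≡-sym e) (irrefl G x)
... | ()

colouring-resp : (G : Graph n) {c d : Assignment n k} → Agree G c d →
  IsEdgeColouring G k c → IsEdgeColouring G k d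
symmetric (colouring-resp G p C) x y e =
  trans (≡-sym (p x y e)) (trans (symmetric C x y e) (p y x (adj-sym G e)))
proper (colouring-resp G p C) x y z e f y≢z q =
  proper C x y z e f y≢z (trans (p x y e) (trans q (≡-sym (p x z f))))

-- Closed sets and interchanges along them

Bi : Graph n → Assignment n k → Fin k → Fin k → Fin n → Fin n → Set
Bi G c a b x y = Adj G x y × OneOf a b (c x y)

bi? : (G : Graph n) (c : Assignment n k) (a b : Fin k) → Decidable (Bi G c a b)
bi? G c a b x y = adj? G x y ×-dec oneOf? a b (c x y)

bi-sym : {G : Graph n} {c : Assignment n k} {a b : Fin k} {x y : Fin n} →
  IsEdgeColouring G k c → Bi G c a b x y → Bi G c a b y x
bi-sym {G = G} {a = a} {b} C (e , o) = adj-sym G e , subst (OneOf a b) (symmetric C _ _ e) o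

-- The closed sets are the unions of components of the {a,b}-subgraph, so one switch below amounts
-- to several Kempe changes.
record Closed (G : Graph n) (c : Assignment n k) (a b : Fin k) (S : Fin n → Bool) : Set where
  constructor closed
  field
    bi⇒≡ : ∀ x y → Bi G c a b x y → S x ≡ S y
open Closed public

closed-resp : (G : Graph n) {c d : Assignment n k} {a b : Fin k} {S : Fin n → Bool} →
  Agree G c d → Closed G c a b S → Closed G d a b S
bi⇒≡ (closed-resp G {a = a} {b} p cl) x y (e , o) =
  bi⇒≡ cl x y (e , subst (OneOf a b) (≡-sym (p x y e)) o)

-- Testing only the first end is enough: for a closed `S`, both ends of an edge coloured `a` or `b`
-- lie on the same side, and the swap fixes every other colour.
interchange : (Fin n → Bool) → Fin k → Fin k → Assignment n k → Assignment n k
interchange S a b c x y = if S x then swap a b (c x y) else c x y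

interchange-in : (S : Fin n → Bool) (a b : Fin k) (c : Assignment n k) {x : Fin n} (y : Fin n) →
  S x ≡ true → interchange S a b c x y ≡ swap a b (c x y)
interchange-in S a b c {x} y e rewrite e = refl

interchange-out : (S : Fin n → Bool) (a b : Fin k) (c : Assignment n k) {x : Fin n} (y : Fin n) →
  S x ≡ false → interchange S a b c x y ≡ c x y
interchange-out S a b c {x} y e rewrite e = refl

interchange-other : (S : Fin n → Bool) {a b : Fin k} (c : Assignment n k) (x y : Fin n) →
  ¬ OneOf a b (c x y) → interchange S a b c x y ≡ c x y
interchange-other S c x y p with S x
... | true = swap-avoids p
... | false = refl

interchange-oneOf : (S : Fin n → Bool) {a b : Fin k} (c : Assignment n k) (x y : Fin n) →
  OneOf a b (c x y) → OneOf a b (interchange S a b c x y)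
interchange-oneOf S c x y p with S x
... | true = swap-oneOf p
... | false = p

interchange-oneOf⁻ : (S : Fin n → Bool) {a b : Fin k} (c : Assignment n k) (x y : Fin n) →
  OneOf a b (interchange S a b c x y) → OneOf a b (c x y)
interchange-oneOf⁻ S c x y p with S x
... | true = swap-oneOf⁻ p
... | false = p

interchange-involutive : (S : Fin n → Bool) (a b : Fin k) (c : Assignment n k) (x y : Fin n) →
  interchange S a b (interchange S a b c) x y ≡ c x y
interchange-involutive S a b c x y with S x
... | true = swap-involutive a b (c x y)
... | false = refl

interchange-resp : (G : Graph n) (S : Fin n → Bool) (a b : Fin k) {c d : Assignment n k} →
  Agree G c d → Agree G (interchange S a b c) (interchange S a b d)
interchange-resp G S a b p x y e with S x
... | true = cong (swap a b) (p x y e)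
... | false = p x y e

interchange-interchange : (S T : Fin n → Bool) {a b i j : Fin k} →
  i ≢ a → i ≢ b → j ≢ a → j ≢ b → (c : Assignment n k) → ∀ x y →
  interchange S a b (interchange T i j c) x y ≡ interchange T i j (interchange S a b c) x y
interchange-interchange S T p q r s c x y with S x | T x
... | true | true = swap-swap p q r s (c x y)
... | true | false = refl
... | false | true = refl
... | false | false = refl

interchange-closed : {G : Graph n} {c : Assignment n k} {a b : Fin k} (S : Fin n → Bool) {T : Fin n → Bool} →
  Closed G c a b T → Closed G (interchange S a b c) a b T
bi⇒≡ (interchange-closed {c = c} S cl) x y (e , o) = bi⇒≡ cl x y (e , interchange-oneOf⁻ S c x y o)

-- A swap of `i` and `j` does not alter which edges have colour `a` or `b`.
interchange-closed-disjoint : {G : Graph n} {c : Assignment n k} {a b i j : Fin k} (T : Fin n → Bool) {S : Fin n → Bool} →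
  i ≢ a → i ≢ b → j ≢ a → j ≢ b →
  Closed G c a b S → Closed G (interchange T i j c) a b S
bi⇒≡ (interchange-closed-disjoint {c = c} {a} {b} {i} {j} T p q r s cl) x y (e , o) = bi⇒≡ cl x y (e , o′)
  where
    o′ : OneOf a b (c x y)
    o′ with oneOf? i j (c x y)
    ... | no ¬o = subst (OneOf a b) (interchange-other T c x y ¬o) o
    ... | yes ij with interchange-oneOf T c x y ij
    ...   | inj₁ t = ⊥-elim ([ (λ u → p (trans (≡-sym t) u)) , (λ u → q (trans (≡-sym t) u)) ] o)
    ...   | inj₂ t = ⊥-elim ([ (λ u → r (trans (≡-sym t) u)) , (λ u → s (trans (≡-sym t) u)) ] o)

-- At a fixed vertex one injective map acts on all edges, so properness is inherited; it is symmetry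
-- that rests on `S` being closed.
interchange-colouring : {G : Graph n} {c : Assignment n k} {a b : Fin k} {S : Fin n → Bool} →
  Closed G c a b S → IsEdgeColouring G k c → IsEdgeColouring G k (interchange S a b c)
symmetric (interchange-colouring {G = G} {c = c} {a} {b} {S} cl C) x y e
  with oneOf? a b (c x y)
... | yes o rewrite bi⇒≡ cl x y (e , o) | symmetric C x y e = refl
... | no ¬o = trans (interchange-other S c x y ¬o) (trans (symmetric C x y e)
  (≡-sym (interchange-other S c y x (¬o ∘ subst (OneOf a b) (≡-sym (symmetric C x y e))))))
proper (interchange-colouring {a = a} {b} {S} cl C) x y z e f y≢z q with S x
... | true = proper C x y z e f y≢z (swap-injective a b q)
... | false = proper C x y z e f y≢z q

-- The equivalence generated by switches

infix 4 _⊢_~_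

data _⊢_~_ (G : Graph n) (c d : Assignment n k) : Set where
  agree  : Agree G c d → G ⊢ c ~ d
  switch : ∀ {a b S} → Closed G c a b S → G ⊢ interchange S a b c ~ d → G ⊢ c ~ d

~-respˡ : (G : Graph n) {c c′ d : Assignment n k} → Agree G c c′ → G ⊢ c′ ~ d → G ⊢ c ~ d
~-respˡ G p (agree q) = agree (agree-trans G p q)
~-respˡ G p (switch {a} {b} {S} cl q) =
  switch (closed-resp G (agree-sym G p) cl) (~-respˡ G (interchange-resp G S a b p) q)

~-trans : {G : Graph n} {c d e : Assignment n k} → G ⊢ c ~ d → G ⊢ d ~ e → G ⊢ c ~ e
~-trans {G = G} (agree p) q = ~-respˡ G p q
~-trans (switch cl p) q = switch cl (~-trans p q)

~-sym : {G : Graph n} {c d : Assignment n k} → G ⊢ c ~ d → G ⊢ d ~ c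
~-sym {G = G} (agree p) = agree (agree-sym G p)
~-sym {c = c} (switch {a} {b} {S} cl p) = ~-trans (~-sym p)
  (switch (interchange-closed S cl) (agree (λ x y _ → interchange-involutive S a b c x y)))

switch₁ : {G : Graph n} {c : Assignment n k} {a b : Fin k} {S : Fin n → Bool} →
  Closed G c a b S → G ⊢ c ~ interchange S a b c
switch₁ {G = G} {c} cl = switch cl (agree (λ x y _ → refl))

-- Switches as sequences of Kempe changes

Kempe : Graph n → Assignment n k → Assignment n k → Set
Kempe G c d = ∃[ e ] (Star (KempeChange G) c e × Agree G e d)

InComponent-resp : (G : Graph n) {c d : Assignment n k} {a b : Fin k} {u v x y : Fin n} →
  Agree G c d → InComponent G c a b u v x y → InComponent G d a b u v x y
InComponent-resp G p base = base
InComponent-resp G p (flip i) = flip (InComponent-resp G p i)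
InComponent-resp G {a = a} {b} p (step i e o) =
  step (InComponent-resp G p i) e (subst (OneOf a b) (p _ _ e) o)

KempeChange-resp : (G : Graph n) {c c′ d : Assignment n k} →
  Agree G c c′ → KempeChange G c′ d → KempeChange G c d
KempeChange-resp G p (a , b , a≢b , u , v , e , o , h) =
  a , b , a≢b , u , v , e , subst (OneOf a b) (≡-sym (p u v e)) o , λ x y f →
    (λ i → trans (proj₁ (h x y f) (InComponent-resp G p i)) (cong (swap a b) (≡-sym (p x y f)))) ,
    (λ ¬i → trans (proj₂ (h x y f) (¬i ∘ InComponent-resp G (agree-sym G p))) (≡-sym (p x y f)))

kempe-respˡ : (G : Graph n) {c c′ d : Assignment n k} → Agree G c c′ → Kempe G c′ d → Kempe G c d
kempe-respˡ G p (_ , ε , q) = _ , ε , agree-trans G p q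
kempe-respˡ G p (e , s ◅ ss , q) = e , KempeChange-resp G p s ◅ ss , q

kempe-trans : (G : Graph n) {c d e : Assignment n k} → Kempe G c d → Kempe G d e → Kempe G c e
kempe-trans G (_ , ε , p) q = kempe-respˡ G p q
kempe-trans G (_ , s ◅ ss , p) q with kempe-trans G (_ , ss , p) q
... | e , ts , r = e , s ◅ ts , r

kempe-respʳ : (G : Graph n) {c d d′ : Assignment n k} → Kempe G c d → Agree G d d′ → Kempe G c d′
kempe-respʳ G (e , ss , p) q = e , ss , agree-trans G p q

module Component {G : Graph n} {c : Assignment n k} (C : IsEdgeColouring G k c) (a b : Fin k) where

  open Reachability (bi? G c a b) using (star?)

  Conn : Fin n → Fin n → Set
  Conn = Star (Bi G c a b)

  comp : Fin n → Fin n → Bool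
  comp x y = does (star? x y)

  comp-closed : ∀ x → Closed G c a b (comp x)
  bi⇒≡ (comp-closed x) y z r =
    does-⇔ (mk⇔ (_◅◅ (r ◅ ε)) (_◅◅ (bi-sym {G = G} C r ◅ ε))) (star? x y) (star? x z)

  comp-true : ∀ {x y} → Conn x y → comp x y ≡ true
  comp-true {x} {y} p = dec-true (star? x y) p

  comp-sound : ∀ {x y} → comp x y ≡ true → Conn x y
  comp-sound {x} {y} p with star? x y
  ... | yes q = q
  comp-sound () | no _

  closed-conn : ∀ {S x y} → Closed G c a b S → Conn x y → S x ≡ S y
  closed-conn cl ε = refl
  closed-conn cl (r ◅ rs) = trans (bi⇒≡ cl _ _ r) (closed-conn cl rs)

  inComponent⇒ : ∀ {x z u v} → Bi G c a b x z → InComponent G c a b x z u v → Conn x u × Bi G c a b u v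
  inComponent⇒ r base = ε , r
  inComponent⇒ r (flip i) with inComponent⇒ r i
  ... | p , q = p ◅◅ (q ◅ ε) , bi-sym {G = G} C q
  inComponent⇒ r (step i e o) with inComponent⇒ r i
  ... | p , q = p ◅◅ (q ◅ ε) , e , o

  ⇒inComponent : ∀ {x z u v} → Conn x u → Bi G c a b u v → InComponent G c a b x z u v
  -- A `step` continues an edge that ends where the new one starts; `flip base` ends at `x` and so
  -- serves even the empty walk.
  ⇒inComponent {x} {z} p (e , o) = step (proj₂ (reach p (z , flip base))) e o
    where
      reach : ∀ {v u} → Conn v u → (∃[ w ] InComponent G c a b x z w v) → ∃[ w ] InComponent G c a b x z w u
      reach ε i = i
      reach ((e , o) ◅ rs) (w , i) = reach rs (_ , step i e o)

  -- A Kempe change demands two distinct colours and an edge to start from. If the colours are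
  -- equal, or if no edge at `x` has one of them, the interchange changes nothing and the empty
  -- sequence serves.
  kempe-comp : ∀ x → Kempe G c (interchange (comp x) a b c)
  kempe-comp x with a ≟ b
  ... | yes refl = c , ε , λ u v _ → same u v
    where
      same : ∀ u v → c u v ≡ interchange (comp x) a a c u v
      same u v with comp x u
      ... | true = ≡-sym (swap-same a (c u v))
      ... | false = refl
  ... | no a≢b with any? (bi? G c a b x)
  ...   | no isolated = c , ε , λ u v e → ≡-sym (same u v e)
    where
      stay : ∀ {u} → Conn x u → x ≡ u
      stay ε = refl
      stay (r ◅ _) = contradiction (_ , r) isolated
      same : ∀ u v → Adj G u v → interchange (comp x) a b c u v ≡ c u v
      same u v e with star? x u
      ... | no _ = refl
      ... | yes p with stay p
      ...   | refl = swap-avoids (λ o → isolated (v , e , o))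
  ...   | yes (z , r) = _ , change ◅ ε , λ _ _ _ → refl
    where
      change : KempeChange G c (interchange (comp x) a b c)
      change = a , b , a≢b , x , z , proj₁ r , proj₂ r , λ u v e →
        (λ i → interchange-in (comp x) a b c v (comp-true (proj₁ (inComponent⇒ r i)))) ,
        outside u v e
        where
          outside : ∀ u v → Adj G u v → ¬ InComponent G c a b x z u v →
            interchange (comp x) a b c u v ≡ c u v
          outside u v e ¬i with star? x u
          ... | no _ = refl
          ... | yes p = swap-avoids (λ o → ¬i (⇒inComponent p (e , o)))

-- The list bounds what is still to be interchanged. If its head `v` lies in `S`, so does the whole
-- component of `v`; one Kempe change deals with it, and the rest of `S` is closed and contained in
-- the tail.
kempe-closed : (G : Graph n) (a b : Fin k) (vs : List (Fin n)) (S : Fin n → Bool) {c : Assignment n k} →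
  IsEdgeColouring G k c → Closed G c a b S → (∀ x → S x ≡ true → x ∈ vs) →
  Kempe G c (interchange S a b c)
kempe-closed G a b [] S {c} C cl ⊆vs = c , ε , λ x y _ → ≡-sym (interchange-out S a b c y (outside x))
  where
    outside : ∀ x → S x ≡ false
    outside x with S x in eq
    ... | false = refl
    ... | true with ⊆vs x eq
    ...   | ()
kempe-closed G a b (v ∷ vs) S {c} C cl ⊆vs with S v in Sv
... | false = kempe-closed G a b vs S C cl ⊆vs′
  where
    ⊆vs′ : ∀ x → S x ≡ true → x ∈ vs
    ⊆vs′ x Sx with ⊆vs x Sx
    ... | there x∈ = x∈
    ... | here refl with trans (≡-sym Sx) Sv
    ...   | ()
... | true = kempe-respʳ G (kempe-trans G (kempe-comp v) rest) (λ x y _ → combine x y)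
  where
    open Component {G = G} C a b
    T : Fin _ → Bool
    T x = S x ∧ not (comp v x)
    T-closed : Closed G c a b T
    bi⇒≡ T-closed x y r = cong₂ (λ p q → p ∧ not q) (bi⇒≡ cl x y r) (bi⇒≡ (comp-closed v) x y r)
    ⊆vs′ : ∀ x → T x ≡ true → x ∈ vs
    ⊆vs′ x Tx with S x in Sx | comp v x in vx
    ... | true | false with ⊆vs x Sx
    ...   | there x∈ = x∈
    ...   | here refl with trans (≡-sym vx) (comp-true ε)
    ...     | ()
    ⊆vs′ x () | true | true
    ⊆vs′ x () | false | _
    rest = kempe-closed G a b vs T (interchange-colouring (comp-closed v) C)
      (interchange-closed (comp v) T-closed) ⊆vs′
    combine : ∀ x y → interchange T a b (interchange (comp v) a b c) x y ≡ interchange S a b c x y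
    combine x y with S x in Sx | comp v x in vx
    ... | true | true = refl
    ... | true | false = refl
    ... | false | false = refl
    ... | false | true with trans (≡-sym Sx) (trans (≡-sym (closed-conn cl (comp-sound vx))) Sv)
    ...   | ()

~⇒kempe : {G : Graph n} {c d : Assignment n k} → IsEdgeColouring G k c → G ⊢ c ~ d → Kempe G c d
~⇒kempe C (agree p) = _ , ε , p
~⇒kempe {G = G} C (switch {a} {b} {S} cl p) =
  kempe-trans G (kempe-closed G a b (allFin _) S C cl (λ x _ → ∈-allFin x))
    (~⇒kempe (interchange-colouring cl C) p)

-- A component of the {a,b}-subgraph is a path or a cycle, so it has at most two ends.
-- The path is followed through its directed edges, on which the successor is unique.
module Ends {G : Graph n} {c : Assignment n k} (C : IsEdgeColouring G k c) (a b : Fin k) where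

  private
    B : Fin n → Fin n → Set
    B = Bi G c a b

  IsEnd : Fin n → Set
  IsEnd p = ∀ y z → B p y → B p z → y ≡ z

  data Successor : Fin n × Fin n → Fin n × Fin n → Set where
    next : ∀ {y z x} → B y z → B z x → x ≢ y → Successor (y , z) (z , x)

  same-colour : ∀ {z x y} → B z x → B z y → c z x ≡ c z y → x ≡ y
  same-colour {z} {x} {y} (e , _) (f , _) q = decidable-stable (x ≟ y) (λ x≢y → proper C z x y e f x≢y q)

  -- At `z` there is at most one edge of each of the two colours, and one of these edges leads back
  -- to `y`.
  successor-unique : ∀ {e f g} → Successor e f → Successor e g → f ≡ g
  successor-unique (next {y} {z} {x} r s x≢y) (next {x = x′} _ s′ x′≢y) = cong (z ,_) (go (proj₂ (bi-sym {G = G} C r)) (proj₂ s) (proj₂ s′))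
    where
      t = bi-sym {G = G} C r
      go : OneOf a b (c z y) → OneOf a b (c z x) → OneOf a b (c z x′) → x ≡ x′
      go (inj₁ p) (inj₁ q) _ = contradiction (same-colour s t (trans q (≡-sym p))) x≢y
      go (inj₁ p) (inj₂ q) (inj₁ q′) = contradiction (same-colour s′ t (trans q′ (≡-sym p))) x′≢y
      go (inj₁ p) (inj₂ q) (inj₂ q′) = same-colour s s′ (trans q (≡-sym q′))
      go (inj₂ p) (inj₂ q) _ = contradiction (same-colour s t (trans q (≡-sym p))) x≢y
      go (inj₂ p) (inj₁ q) (inj₂ q′) = contradiction (same-colour s′ t (trans q′ (≡-sym p))) x′≢y
      go (inj₂ p) (inj₁ q) (inj₁ q′) = same-colour s s′ (trans q (≡-sym q′))

  terminal-unique : ∀ {e f g} → Star Successor e f → Star Successor e g →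
    (∀ {h} → ¬ Successor f h) → (∀ {h} → ¬ Successor g h) → f ≡ g
  terminal-unique ε ε _ _ = refl
  terminal-unique ε (s ◅ _) tf _ = contradiction s tf
  terminal-unique (s ◅ _) ε _ tg = contradiction s tg
  terminal-unique (s ◅ ss) (t ◅ ts) tf tg with successor-unique s t
  ... | refl = terminal-unique ss ts tf tg

  end-terminal : ∀ {y p h} → IsEnd p → ¬ Successor (y , p) h
  end-terminal endp (next r s x≢y) = x≢y (endp _ _ s (bi-sym {G = G} C r))

  data Trail (p : Fin n) : Fin n → Fin n → Set where
    start : ∀ {z} → B p z → Trail p p z
    extend : ∀ {y z x} → Trail p y z → B z x → x ≢ y → Trail p z x

  trail-last : ∀ {p y z} → Trail p y z → B y z
  trail-last (start r) = r
  trail-last (extend _ r _) = r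

  trail-star : ∀ {p y z z₀} → IsEnd p → B p z₀ → Trail p y z → Star Successor (p , z₀) (y , z)
  trail-star {p} endp r₀ (start r) with endp _ _ r₀ r
  ... | refl = ε
  trail-star endp r₀ (extend t r x≢y) = trail-star endp r₀ t ◅◅ (next (trail-last t) r x≢y ◅ ε)

  -- Walks may turn back and trails may not: a step back along the last edge removes that edge from
  -- the trail.
  trail-to : ∀ {p x} → Star B p x → p ≡ x ⊎ ∃[ y ] Trail p y x
  trail-to {p} = walk (inj₁ refl)
    where
      walk : ∀ {v x} → p ≡ v ⊎ (∃[ y ] Trail p y v) → Star B v x → p ≡ x ⊎ (∃[ y ] Trail p y x)
      walk t ε = t
      walk (inj₁ refl) (r ◅ rs) = walk (inj₂ (p , start r)) rs
      walk (inj₂ (y , t)) (_◅_ {j = w} r rs) with w ≟ y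
      ... | no w≢y = walk (inj₂ (_ , extend t r w≢y)) rs
      walk (inj₂ (y , start _)) (r ◅ rs) | yes refl = walk (inj₁ refl) rs
      walk (inj₂ (y , extend t _ _)) (r ◅ rs) | yes refl = walk (inj₂ (_ , t)) rs

  trail-first : ∀ {p y z} → Trail p y z → ∃[ z₀ ] B p z₀
  trail-first (start r) = _ , r
  trail-first (extend t _ _) = trail-first t

  -- Since `p` is an end, both trails leave it by the same edge and then follow the same chain of
  -- unique successors. At an end the chain cannot go on, so both stop at the same edge.
  two-ends : ∀ {p q r} → IsEnd p → IsEnd q → IsEnd r → p ≢ q → p ≢ r →
    Star B p q → Star B p r → q ≡ r
  two-ends endp endq endr p≢q p≢r ss ts with trail-to ss | trail-to ts
  ... | inj₁ e | _ = contradiction e p≢q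
  ... | inj₂ _ | inj₁ e = contradiction e p≢r
  ... | inj₂ (_ , t) | inj₂ (_ , t′) with trail-first t
  ...   | z₀ , r₀ = cong proj₂ (terminal-unique (trail-star endp r₀ t) (trail-star endp r₀ t′)
                      (end-terminal endq) (end-terminal endr))

-- Neighbourhoods and deletion of a vertex

neighbours : Graph n → Fin n → List (Fin n)
neighbours {n} G w = filter (adj? G w) (allFin n)

∈-neighbours : (G : Graph n) {w v : Fin n} → Adj G w v → v ∈ neighbours G w
∈-neighbours G {w} e = ∈-filter⁺ (adj? G w) (∈-allFin _) e

∈-neighbours⁻ : (G : Graph n) {w v : Fin n} → v ∈ neighbours G w → Adj G w v
∈-neighbours⁻ {n} G {w} p = proj₂ (∈-filter⁻ (adj? G w) {xs = allFin n} p)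

neighbours-unique : (G : Graph n) (w : Fin n) → Unique (neighbours G w)
neighbours-unique {n} G w = filter⁺ (adj? G w) (allFin⁺ n)

-- This is `G − u` with `u` kept as an isolated vertex: the vertex set stays `Fin n`, and a
-- colouring of `G` is already one of the smaller graph.
isolate : Graph n → Fin n → Graph n
adj (isolate G u) x y = adj G x y ∧ (not (does (x ≟ u)) ∧ not (does (y ≟ u)))
sym (isolate G u) x y = cong₂ _∧_ (sym G x y) (Bool.∧-comm (not (does (x ≟ u))) _)
irrefl (isolate G u) x rewrite irrefl G x = refl

isolate-adj⁻ : (G : Graph n) (u : Fin n) {x y : Fin n} →
  Adj (isolate G u) x y → Adj G x y × x ≢ u × y ≢ u
isolate-adj⁻ G u {x} {y} e with adj G x y in xy | x ≟ u | y ≟ u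
... | true | no p | no q = refl , p , q
isolate-adj⁻ G u () | true | yes _ | _
isolate-adj⁻ G u () | true | no _ | yes _
isolate-adj⁻ G u () | false | _ | _

isolate-adj : (G : Graph n) (u : Fin n) {x y : Fin n} →
  Adj G x y → x ≢ u → y ≢ u → Adj (isolate G u) x y
isolate-adj G u {x} {y} e p q rewrite e | dec-false (x ≟ u) p | dec-false (y ≟ u) q = refl

isolate-colouring : (G : Graph n) (u : Fin n) {c : Assignment n k} →
  IsEdgeColouring G k c → IsEdgeColouring (isolate G u) k c
symmetric (isolate-colouring G u C) x y e = symmetric C x y (proj₁ (isolate-adj⁻ G u e))
proper (isolate-colouring G u C) x y z e f =
  proper C x y z (proj₁ (isolate-adj⁻ G u e)) (proj₁ (isolate-adj⁻ G u f))

-- The edges at u carry a colouring s of the neighbours by the colours that are free there in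
-- a colouring c of G − u.
module AtVertex {n k : ℕ} (G : Graph n) (u : Fin n)
  (few : length (neighbours G u) ≤ 4)
  (room : ∀ w → length (neighbours G w) + 2 ≤ k) where

  H : Graph n
  H = isolate G u

  N : Fin n → Set
  N w = Adj G u w

  N⇒≢ : ∀ {w} → N w → w ≢ u
  N⇒≢ e refl = adj⇒≢ G e refl

  -- Free colours and extensions to the edges at `u`

  Free : Assignment n k → Fin n → Fin k → Set
  Free c w t = ∀ v → Adj H w v → c w v ≢ t

  free? : ∀ c w t → Dec (Free c w t)
  free? c w t = all? (λ v → adj? H w v →-dec ¬? (c w v ≟ t))

  free-resp : ∀ {c d w t} → Agree H c d → Free c w t → Free d w t
  free-resp p f v e q = f v e (trans (p _ v e) q)

  -- The edge from `w` to `u` is absent in `H`, so at least three colours are free at `w` and two of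
  -- them can be avoided.
  pick : ∀ c {w} → N w → ∀ y₁ y₂ → ∃[ t ] (Free c w t × t ≢ y₁ × t ≢ y₂)
  pick c {w} Nw y₁ y₂ with absent-colour (y₂ ∷ map f (neighbours G w)) small
    where
      f : Fin n → Fin k
      f v = if does (v ≟ u) then y₁ else c w v
      -- The entry of `u` among the neighbours of `w` carries `y₁`, so avoiding `y₁` costs no extra
      -- place and only `y₂` lengthens the list.
      small : suc (length (map f (neighbours G w))) < k
      small rewrite length-map f (neighbours G w) =
        subst (_≤ k) (ℕ.+-comm (length (neighbours G w)) 2) (room w)
  ... | t , t∉ = t , free , t≢y₁ , t∉ ∘ here
    where
      f : Fin n → Fin k
      f v = if does (v ≟ u) then y₁ else c w v
      f-u : f u ≡ y₁
      f-u rewrite dec-true (u ≟ u) refl = refl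
      f-other : ∀ {v} → v ≢ u → f v ≡ c w v
      f-other {v} p rewrite dec-false (v ≟ u) p = refl
      t≢y₁ : t ≢ y₁
      t≢y₁ q = t∉ (there (subst (_∈ _) (trans f-u (≡-sym q)) (∈-map⁺ f (∈-neighbours G (adj-sym G Nw)))))
      free : Free c w t
      free v e q with isolate-adj⁻ G u e
      ... | e′ , _ , v≢u = t∉ (there (subst (_∈ _) (trans (f-other v≢u) q) (∈-map⁺ f (∈-neighbours G e′))))

  cover : ∀ {ws w} → Unique ws → All N ws → length ws ≡ 4 → N w → w ∈ ws
  cover {ws} {w} uniq all len Nw with w ∈? ws
    where open DecMembership _≟_ using (_∈?_)
  ... | yes p = p
  ... | no w∉ = contradiction
    (ℕ.≤-trans (unique-subset-length (All.tabulate (λ {v} v∈ q → w∉ (subst (_∈ ws) (≡-sym q) v∈)) ∷ uniq) ⊆) few)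
    (ℕ.<⇒≱ (s≤s (ℕ.≤-reflexive (≡-sym len))))
    where
      ⊆ : ∀ {v} → v ∈ w ∷ ws → v ∈ neighbours G u
      ⊆ (here refl) = ∈-neighbours G Nw
      ⊆ (there v∈) = ∈-neighbours G (All.lookup all v∈)

  record SDR (c : Assignment n k) (s : Fin n → Fin k) : Set where
    constructor sdr
    field
      free : ∀ {w} → N w → Free c w (s w)
      inj  : ∀ {w w′} → N w → N w′ → s w ≡ s w′ → w ≡ w′
  open SDR public

  sdr-resp : ∀ {c d s} → Agree H c d → SDR c s → SDR d s
  free (sdr-resp p R) Nw = free-resp p (free R Nw)
  inj (sdr-resp p R) = inj R

  join : Assignment n k → (Fin n → Fin k) → Assignment n k
  join c s x y = if does (x ≟ u) then s y else (if does (y ≟ u) then s x else c x y)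

  join-left : ∀ c s y → join c s u y ≡ s y
  join-left c s y rewrite dec-true (u ≟ u) refl = refl

  join-right : ∀ c s {x} → x ≢ u → join c s x u ≡ s x
  join-right c s {x} p rewrite dec-false (x ≟ u) p | dec-true (u ≟ u) refl = refl

  join-away : ∀ c s {x y} → Adj H x y → join c s x y ≡ c x y
  join-away c s {x} {y} e with isolate-adj⁻ G u e
  ... | _ , p , q rewrite dec-false (x ≟ u) p | dec-false (y ≟ u) q = refl

  data Edge : Fin n → Fin n → Set where
    left  : ∀ {y} → N y → Edge u y
    right : ∀ {x} → N x → Edge x u
    away  : ∀ {x y} → Adj H x y → Edge x y

  edge : ∀ {x y} → Adj G x y → Edge x y
  edge {x} {y} e with x ≟ u
  ... | yes refl = left e
  ... | no p with y ≟ u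
  ...   | yes refl = right (adj-sym G e)
  ...   | no q = away (isolate-adj G u e p q)

  join-resp : ∀ {c d s t} → Agree H c d → (∀ {w} → N w → s w ≡ t w) → Agree G (join c s) (join d t)
  join-resp {c} {d} {s} {t} p q x y e with edge e
  ... | left Ny = trans (join-left c s y) (trans (q Ny) (≡-sym (join-left d t y)))
  ... | right Nx = trans (join-right c s (N⇒≢ Nx)) (trans (q Nx) (≡-sym (join-right d t (N⇒≢ Nx))))
  ... | away e′ = trans (join-away c s e′) (trans (p x y e′) (≡-sym (join-away d t e′)))

  join-colouring : ∀ {c s} → IsEdgeColouring H k c → SDR c s → IsEdgeColouring G k (join c s)
  symmetric (join-colouring {c} {s} C R) x y e with edge e
  ... | left Ny = trans (join-left c s y) (≡-sym (join-right c s (N⇒≢ Ny)))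
  ... | right Nx = trans (join-right c s (N⇒≢ Nx)) (≡-sym (join-left c s x))
  ... | away e′ = trans (join-away c s e′)
    (trans (symmetric C x y e′) (≡-sym (join-away c s (adj-sym H e′))))
  proper (join-colouring {c} {s} C R) x y z e f y≢z q with edge e | edge f
  ... | left Ny | left Nz =
    y≢z (inj R Ny Nz (trans (≡-sym (join-left c s y)) (trans q (join-left c s z))))
  ... | left Ny | right Nx = N⇒≢ Nx refl
  ... | left Ny | away f′ = proj₁ (proj₂ (isolate-adj⁻ G u f′)) refl
  ... | right Nx | left Nz = N⇒≢ Nx refl
  ... | right Nx | right _ = y≢z refl
  ... | right Nx | away f′ =
    free R Nx z f′ (trans (≡-sym (join-away c s f′)) (trans (≡-sym q) (join-right c s (N⇒≢ Nx))))
  ... | away e′ | left Nz = proj₁ (proj₂ (isolate-adj⁻ G u e′)) refl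
  ... | away e′ | right Nx =
    free R Nx y e′ (trans (≡-sym (join-away c s e′)) (trans q (join-right c s (N⇒≢ Nx))))
  ... | away e′ | away f′ =
    proper C x y z e′ f′ y≢z (trans (≡-sym (join-away c s e′)) (trans q (join-away c s f′)))

  star-sdr : ∀ {χ c} → IsEdgeColouring G k χ → Agree H χ c → SDR c (χ u)
  free (star-sdr X p) {w} Nw v e q with isolate-adj⁻ G u e
  ... | e′ , _ , v≢u = proper X w v u e′ (adj-sym G Nw) v≢u
    (trans (p w v e) (trans q (symmetric X u w Nw)))
  inj (star-sdr X p) {w} {w′} Nw Nw′ q =
    decidable-stable (w ≟ w′) (λ w≢w′ → proper X u w w′ Nw Nw′ w≢w′ q)

  star-join : ∀ {χ c} → IsEdgeColouring G k χ → Agree H χ c → Agree G χ (join c (χ u))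
  star-join {χ} {c} X p x y e with edge e
  ... | left Ny = ≡-sym (join-left c (χ u) y)
  ... | right Nx = trans (symmetric X x y e) (≡-sym (join-right c (χ u) (N⇒≢ Nx)))
  ... | away e′ = trans (p x y e′) (≡-sym (join-away c (χ u) e′))

  -- Lifting an interchange, and moves at `u`

  Reaches : Assignment n k → (Fin n → Fin k) → Assignment n k → (Fin n → Fin k) → Set
  Reaches c s d t = SDR d t × G ⊢ join c s ~ join d t

  reaches-trans : ∀ {c s d t e r} → Reaches c s d t → Reaches d t e r → Reaches c s e r
  reaches-trans (_ , p) (R , q) = R , ~-trans p q

  -- Putting u on the side β of K keeps K closed.
  lift : ∀ {c s a b K} β → IsEdgeColouring H k c → SDR c s → Closed H c a b K →
    (∀ {w} → N w → OneOf a b (s w) → K w ≡ β) →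
    ∃[ t ] Reaches c s (interchange K a b c) t
  lift {c} {s} {a} {b} {K} β C R cl side =
    χ u , star-sdr X agrees , ~-trans (switch₁ S-closed) (agree (star-join X agrees))
    where
      S : Fin n → Bool
      S x = if does (x ≟ u) then β else K x
      S-u : S u ≡ β
      S-u rewrite dec-true (u ≟ u) refl = refl
      S-other : ∀ {x} → x ≢ u → S x ≡ K x
      S-other {x} p rewrite dec-false (x ≟ u) p = refl
      S-closed : Closed G (join c s) a b S
      bi⇒≡ S-closed x y (e , o) with edge e
      ... | left Ny = trans S-u (≡-sym (trans (S-other (N⇒≢ Ny))
        (side Ny (subst (OneOf a b) (join-left c s y) o))))
      ... | right Nx = trans (S-other (N⇒≢ Nx))
        (trans (side Nx (subst (OneOf a b) (join-right c s (N⇒≢ Nx)) o)) (≡-sym S-u))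
      ... | away e′ with isolate-adj⁻ G u e′
      ...   | _ , p , q = trans (S-other p)
        (trans (bi⇒≡ cl x y (e′ , subst (OneOf a b) (join-away c s e′) o)) (≡-sym (S-other q)))
      χ : Assignment n k
      χ = interchange S a b (join c s)
      X : IsEdgeColouring G k χ
      X = interchange-colouring S-closed (join-colouring C R)
      agrees : Agree H χ (interchange K a b c)
      agrees x y e with isolate-adj⁻ G u e
      ... | _ , p , q = trans (cong₂ (λ β t → if β then swap a b t else t) (S-other p) (join-away c s e)) refl

  -- Both colours are free in `H` at every neighbour whose edge to `u` has one of them. So `u` and
  -- these neighbours form a closed set in `G`, and switching it changes edges at `u` only.
  recolour : ∀ {c s} a b → IsEdgeColouring H k c → SDR c s →
    (∀ {w} → N w → OneOf a b (s w) → Free c w a × Free c w b) → Reaches c s c (swap a b ∘ s)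
  recolour {c} {s} a b C R ok = R′ , switch S-closed (agree agrees)
    where
      R′ : SDR c (swap a b ∘ s)
      free R′ {w} Nw with swapView a b (s w)
      ... | first p q = subst (Free c w) (≡-sym q) (proj₂ (ok Nw (inj₁ p)))
      ... | second p q = subst (Free c w) (≡-sym q) (proj₁ (ok Nw (inj₂ p)))
      ... | other _ _ q = subst (Free c w) (≡-sym q) (free R Nw)
      inj R′ Nw Nw′ q = inj R Nw Nw′ (swap-injective a b q)
      In : Fin n → Set
      In x = x ≡ u ⊎ (N x × OneOf a b (s x))
      in? : ∀ x → Dec (In x)
      in? x = (x ≟ u) ⊎-dec (adj? G u x ×-dec oneOf? a b (s x))
      S : Fin n → Bool
      S x = does (in? x)
      not-away : ∀ {x y} → Adj H x y → In x → ¬ OneOf a b (c x y)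
      not-away e (inj₁ p) _ = proj₁ (proj₂ (isolate-adj⁻ G u e)) p
      not-away e (inj₂ (Nx , o)) (inj₁ q) = proj₁ (ok Nx o) _ e q
      not-away e (inj₂ (Nx , o)) (inj₂ q) = proj₂ (ok Nx o) _ e q
      S-closed : Closed G (join c s) a b S
      bi⇒≡ S-closed x y (e , o) with edge e
      ... | left Ny = trans (dec-true (in? x) (inj₁ refl))
        (≡-sym (dec-true (in? y) (inj₂ (Ny , subst (OneOf a b) (join-left c s y) o))))
      ... | right Nx = trans (dec-true (in? x) (inj₂ (Nx , subst (OneOf a b) (join-right c s (N⇒≢ Nx)) o)))
        (≡-sym (dec-true (in? y) (inj₁ refl)))
      ... | away e′ = trans (dec-false (in? x) (λ i → not-away e′ i o′))
        (≡-sym (dec-false (in? y) (λ i → not-away (adj-sym H e′) i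
          (subst (OneOf a b) (symmetric C x y e′) o′))))
        where o′ = subst (OneOf a b) (join-away c s e′) o
      agrees : Agree G (interchange S a b (join c s)) (join c (swap a b ∘ s))
      agrees x y e with edge e
      ... | left Ny = trans (interchange-in S a b (join c s) y (dec-true (in? u) (inj₁ refl)))
        (trans (cong (swap a b) (join-left c s y)) (≡-sym (join-left c _ y)))
      ... | right Nx = trans (at-right (oneOf? a b (s x))) (≡-sym (join-right c _ (N⇒≢ Nx)))
        where
          at-right : Dec (OneOf a b (s x)) → interchange S a b (join c s) x u ≡ swap a b (s x)
          at-right (yes o) = trans (interchange-in S a b (join c s) u (dec-true (in? x) (inj₂ (Nx , o))))
            (cong (swap a b) (join-right c s (N⇒≢ Nx)))
          at-right (no ¬o) = trans (interchange-other S (join c s) x u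
              (¬o ∘ subst (OneOf a b) (join-right c s (N⇒≢ Nx))))
            (trans (join-right c s (N⇒≢ Nx)) (≡-sym (swap-avoids ¬o)))
      ... | away e′ = trans (at-away (in? x)) (≡-sym (join-away c _ e′))
        where
          at-away : Dec (In x) → interchange S a b (join c s) x y ≡ c x y
          at-away (yes i) = trans (interchange-other S (join c s) x y
              (not-away e′ i ∘ subst (OneOf a b) (join-away c s e′))) (join-away c s e′)
          at-away (no ¬i) = trans (interchange-out S a b (join c s) y (dec-false (in? x) ¬i)) (join-away c s e′)

  record Trade (c : Assignment n k) (s : Fin n → Fin k) (w v : Fin n) (x y : Fin k) : Set where
    field
      result  : Fin n → Fin k
      reaches : Reaches c s c result
      at₁     : result w ≡ y
      at₂     : result v ≡ x
      rest    : ∀ {z} → N z → z ≢ w → z ≢ v → result z ≡ s z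

  -- By injectivity, `w` and `v` alone hold the two colours, so these are the only places where both
  -- must be free.
  trade : ∀ {c s w v x y} → IsEdgeColouring H k c → SDR c s → N w → N v → s w ≡ x → s v ≡ y →
    Free c w y → Free c v x → Trade c s w v x y
  trade {c} {s} {w} {v} C R Nw Nv refl refl fw fv = record
    { result = swap (s w) (s v) ∘ s
    ; reaches = recolour (s w) (s v) C R ok
    ; at₁ = swap-first (s w) (s v)
    ; at₂ = swap-second (s w) (s v)
    ; rest = λ Nz z≢w z≢v → swap-other (z≢w ∘ inj R Nz Nw) (z≢v ∘ inj R Nz Nv)
    }
    where
      ok : ∀ {z} → N z → OneOf (s w) (s v) (s z) → Free c z (s w) × Free c z (s v)
      ok Nz (inj₁ p) with inj R Nz Nw p
      ... | refl = free R Nw , fw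
      ok Nz (inj₂ p) with inj R Nz Nv p
      ... | refl = fv , free R Nv

  record Shift (c : Assignment n k) (s : Fin n → Fin k) (w : Fin n) (t : Fin k) : Set where
    field
      result  : Fin n → Fin k
      reaches : Reaches c s c result
      at      : result w ≡ t
      rest    : ∀ {z} → N z → z ≢ w → result z ≡ s z

  Unused : (Fin n → Fin k) → Fin k → Set
  Unused s t = ∀ {z} → N z → s z ≢ t

  shift : ∀ {c s w t} → IsEdgeColouring H k c → SDR c s → N w → Free c w t → Unused s t → Shift c s w t
  shift {c} {s} {w} {t} C R Nw f unused = record
    { result = swap (s w) t ∘ s
    ; reaches = recolour (s w) t C R ok
    ; at = swap-first (s w) t
    ; rest = λ Nz z≢w → swap-other (z≢w ∘ inj R Nz Nw) (unused Nz)
    }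
    where
      ok : ∀ {z} → N z → OneOf (s w) t (s z) → Free c z (s w) × Free c z t
      ok Nz (inj₁ p) with inj R Nz Nw p
      ... | refl = free R Nw , f
      ok Nz (inj₂ p) = contradiction p (unused Nz)

  used? : ∀ s t → (∃[ z ] (N z × s z ≡ t)) ⊎ Unused s t
  used? s t with any? (λ z → adj? G u z ×-dec (s z ≟ t))
  ... | yes p = inj₁ p
  ... | no ¬p = inj₂ (λ Nz q → ¬p (_ , Nz , q))

  -- Equivalently, no `shift` is available at `w`.
  Saturated : Assignment n k → (Fin n → Fin k) → Fin n → Set
  Saturated c s w = ∀ {r} → Free c w r → ∃[ z ] (N z × s z ≡ r)

  saturated? : ∀ c s w → (∃[ r ] (Free c w r × Unused s r)) ⊎ Saturated c s w
  saturated? c s w with any? (λ r → free? c w r ×-dec ¬? (any? (λ z → adj? G u z ×-dec (s z ≟ r))))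
  ... | yes (r , f , un) = inj₁ (r , f , λ Nz e → un (_ , Nz , e))
  ... | no sat = inj₂ (λ {r} f → decidable-stable (any? (λ z → adj? G u z ×-dec (s z ≟ r))) (λ x → sat (r , f , x)))

  -- All extensions of one colouring are equivalent

  record Quad (w₁ w₂ w₃ w₄ : Fin n) : Set where
    field
      n₁ : N w₁
      n₂ : N w₂
      n₃ : N w₃
      n₄ : N w₄
      ≢₁₂ : w₁ ≢ w₂
      ≢₁₃ : w₁ ≢ w₃
      ≢₁₄ : w₁ ≢ w₄
      ≢₂₃ : w₂ ≢ w₃
      ≢₂₄ : w₂ ≢ w₄
      ≢₃₄ : w₃ ≢ w₄

  rotate-quad : ∀ {w₁ w₂ w₃ w₄} → Quad w₁ w₂ w₃ w₄ → Quad w₂ w₃ w₁ w₄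
  rotate-quad Q = record
    { n₁ = n₂ ; n₂ = n₃ ; n₃ = n₁ ; n₄ = n₄
    ; ≢₁₂ = ≢₂₃ ; ≢₁₃ = ≢-sym ≢₁₂ ; ≢₁₄ = ≢₂₄ ; ≢₂₃ = ≢-sym ≢₁₃ ; ≢₂₄ = ≢₃₄ ; ≢₃₄ = ≢₁₄ }
    where open Quad Q

  data Among (w₁ w₂ w₃ w₄ : Fin n) : Fin n → Set where
    is₁ : Among w₁ w₂ w₃ w₄ w₁
    is₂ : Among w₁ w₂ w₃ w₄ w₂
    is₃ : Among w₁ w₂ w₃ w₄ w₃
    is₄ : Among w₁ w₂ w₃ w₄ w₄

  quad-unique : ∀ {w₁ w₂ w₃ w₄} → Quad w₁ w₂ w₃ w₄ → Unique (w₁ ∷ w₂ ∷ w₃ ∷ w₄ ∷ [])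
  quad-unique Q = (≢₁₂ ∷ ≢₁₃ ∷ ≢₁₄ ∷ []) ∷ (≢₂₃ ∷ ≢₂₄ ∷ []) ∷ (≢₃₄ ∷ []) ∷ [] ∷ []
    where open Quad Q

  among : ∀ {w₁ w₂ w₃ w₄ w} → Quad w₁ w₂ w₃ w₄ → N w → Among w₁ w₂ w₃ w₄ w
  among Q Nw with cover (quad-unique Q) (n₁ ∷ n₂ ∷ n₃ ∷ n₄ ∷ []) refl Nw
    where open Quad Q
  ... | here refl = is₁
  ... | there (here refl) = is₂
  ... | there (there (here refl)) = is₃
  ... | there (there (there (here refl))) = is₄

  record Vals (s : Fin n → Fin k) (w₁ w₂ w₃ w₄ : Fin n) (x₁ x₂ x₃ x₄ : Fin k) : Set where
    constructor vals
    field
      v₁ : s w₁ ≡ x₁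
      v₂ : s w₂ ≡ x₂
      v₃ : s w₃ ≡ x₃
      v₄ : s w₄ ≡ x₄

  unused-vals : ∀ {s w₁ w₂ w₃ w₄ x₁ x₂ x₃ x₄ t} → Quad w₁ w₂ w₃ w₄ → Vals s w₁ w₂ w₃ w₄ x₁ x₂ x₃ x₄ →
    x₁ ≢ t → x₂ ≢ t → x₃ ≢ t → x₄ ≢ t → Unused s t
  unused-vals Q (vals v₁ v₂ v₃ v₄) p₁ p₂ p₃ p₄ Nz q with among Q Nz
  ... | is₁ = p₁ (trans (≡-sym v₁) q)
  ... | is₂ = p₂ (trans (≡-sym v₂) q)
  ... | is₃ = p₃ (trans (≡-sym v₃) q)
  ... | is₄ = p₄ (trans (≡-sym v₄) q)

  module SameColouring {c : Assignment n k} (C : IsEdgeColouring H k c) where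

    ReachVals : (Fin n → Fin k) → (w₁ w₂ w₃ w₄ : Fin n) → (x₁ x₂ x₃ x₄ : Fin k) → Set
    ReachVals s w₁ w₂ w₃ w₄ x₁ x₂ x₃ x₄ =
      ∃[ t ] (Reaches c s c t × Vals t w₁ w₂ w₃ w₄ x₁ x₂ x₃ x₄)

    infixl 5 _⨾_
    _⨾_ : ∀ {s w₁ w₂ w₃ w₄ x₁ x₂ x₃ x₄ y₁ y₂ y₃ y₄} → ReachVals s w₁ w₂ w₃ w₄ x₁ x₂ x₃ x₄ →
      (∀ {t} → SDR c t → Vals t w₁ w₂ w₃ w₄ x₁ x₂ x₃ x₄ → ReachVals t w₁ w₂ w₃ w₄ y₁ y₂ y₃ y₄) →
      ReachVals s w₁ w₂ w₃ w₄ y₁ y₂ y₃ y₄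
    (t , r@(R , _) , v) ⨾ f with f R v
    ... | t′ , r′ , v′ = t′ , reaches-trans {c = c} r r′ , v′

    module _ {w₁ w₂ w₃ w₄} (Q : Quad w₁ w₂ w₃ w₄) where
      open Quad Q

      trade₁₂ : ∀ {s x₁ x₂ x₃ x₄} → Free c w₁ x₂ → Free c w₂ x₁ → SDR c s →
        Vals s w₁ w₂ w₃ w₄ x₁ x₂ x₃ x₄ → ReachVals s w₁ w₂ w₃ w₄ x₂ x₁ x₃ x₄
      trade₁₂ f g R (vals v₁ v₂ v₃ v₄) = result , reaches ,
        vals at₁ at₂ (trans (rest n₃ (≢-sym ≢₁₃) (≢-sym ≢₂₃)) v₃) (trans (rest n₄ (≢-sym ≢₁₄) (≢-sym ≢₂₄)) v₄)
        where open Trade (trade C R n₁ n₂ v₁ v₂ f g)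

      trade₁₃ : ∀ {s x₁ x₂ x₃ x₄} → Free c w₁ x₃ → Free c w₃ x₁ → SDR c s →
        Vals s w₁ w₂ w₃ w₄ x₁ x₂ x₃ x₄ → ReachVals s w₁ w₂ w₃ w₄ x₃ x₂ x₁ x₄
      trade₁₃ f g R (vals v₁ v₂ v₃ v₄) = result , reaches ,
        vals at₁ (trans (rest n₂ (≢-sym ≢₁₂) ≢₂₃) v₂) at₂ (trans (rest n₄ (≢-sym ≢₁₄) (≢-sym ≢₃₄)) v₄)
        where open Trade (trade C R n₁ n₃ v₁ v₃ f g)

      trade₂₃ : ∀ {s x₁ x₂ x₃ x₄} → Free c w₂ x₃ → Free c w₃ x₂ → SDR c s →
        Vals s w₁ w₂ w₃ w₄ x₁ x₂ x₃ x₄ → ReachVals s w₁ w₂ w₃ w₄ x₁ x₃ x₂ x₄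
      trade₂₃ f g R (vals v₁ v₂ v₃ v₄) = result , reaches ,
        vals (trans (rest n₁ ≢₁₂ ≢₁₃) v₁) at₁ at₂ (trans (rest n₄ (≢-sym ≢₂₄) (≢-sym ≢₃₄)) v₄)
        where open Trade (trade C R n₂ n₃ v₂ v₃ f g)

      trade₃₄ : ∀ {s x₁ x₂ x₃ x₄} → Free c w₃ x₄ → Free c w₄ x₃ → SDR c s →
        Vals s w₁ w₂ w₃ w₄ x₁ x₂ x₃ x₄ → ReachVals s w₁ w₂ w₃ w₄ x₁ x₂ x₄ x₃
      trade₃₄ f g R (vals v₁ v₂ v₃ v₄) = result , reaches ,
        vals (trans (rest n₁ ≢₁₃ ≢₁₄) v₁) (trans (rest n₂ ≢₂₃ ≢₂₄) v₂) at₁ at₂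
        where open Trade (trade C R n₃ n₄ v₃ v₄ f g)

      trade₁₄ : ∀ {s x₁ x₂ x₃ x₄} → Free c w₁ x₄ → Free c w₄ x₁ → SDR c s →
        Vals s w₁ w₂ w₃ w₄ x₁ x₂ x₃ x₄ → ReachVals s w₁ w₂ w₃ w₄ x₄ x₂ x₃ x₁
      trade₁₄ f g R (vals v₁ v₂ v₃ v₄) = result , reaches ,
        vals at₁ (trans (rest n₂ (≢-sym ≢₁₂) ≢₂₄) v₂) (trans (rest n₃ (≢-sym ≢₁₃) ≢₃₄) v₃) at₂
        where open Trade (trade C R n₁ n₄ v₁ v₄ f g)

      trade₂₄ : ∀ {s x₁ x₂ x₃ x₄} → Free c w₂ x₄ → Free c w₄ x₂ → SDR c s →
        Vals s w₁ w₂ w₃ w₄ x₁ x₂ x₃ x₄ → ReachVals s w₁ w₂ w₃ w₄ x₁ x₄ x₃ x₂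
      trade₂₄ f g R (vals v₁ v₂ v₃ v₄) = result , reaches ,
        vals (trans (rest n₁ ≢₁₂ ≢₁₄) v₁) at₁ (trans (rest n₃ (≢-sym ≢₂₃) ≢₃₄) v₃) at₂
        where open Trade (trade C R n₂ n₄ v₂ v₄ f g)

      shift₁ : ∀ {s x₁ x₂ x₃ x₄} y → Free c w₁ y → x₁ ≢ y → x₂ ≢ y → x₃ ≢ y → x₄ ≢ y → SDR c s →
        Vals s w₁ w₂ w₃ w₄ x₁ x₂ x₃ x₄ → ReachVals s w₁ w₂ w₃ w₄ y x₂ x₃ x₄
      shift₁ y f p₁ p₂ p₃ p₄ R V@(vals v₁ v₂ v₃ v₄) = result , reaches ,
        vals at (trans (rest n₂ (≢-sym ≢₁₂)) v₂) (trans (rest n₃ (≢-sym ≢₁₃)) v₃) (trans (rest n₄ (≢-sym ≢₁₄)) v₄)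
        where open Shift (shift C R n₁ f (unused-vals Q V p₁ p₂ p₃ p₄))

      shift₃ : ∀ {s x₁ x₂ x₃ x₄} y → Free c w₃ y → x₁ ≢ y → x₂ ≢ y → x₃ ≢ y → x₄ ≢ y → SDR c s →
        Vals s w₁ w₂ w₃ w₄ x₁ x₂ x₃ x₄ → ReachVals s w₁ w₂ w₃ w₄ x₁ x₂ y x₄
      shift₃ y f p₁ p₂ p₃ p₄ R V@(vals v₁ v₂ v₃ v₄) = result , reaches ,
        vals (trans (rest n₁ ≢₁₃) v₁) (trans (rest n₂ ≢₂₃) v₂) at (trans (rest n₄ (≢-sym ≢₃₄)) v₄)
        where open Shift (shift C R n₃ f (unused-vals Q V p₁ p₂ p₃ p₄))

      shift₄ : ∀ {s x₁ x₂ x₃ x₄} y → Free c w₄ y → x₁ ≢ y → x₂ ≢ y → x₃ ≢ y → x₄ ≢ y → SDR c s →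
        Vals s w₁ w₂ w₃ w₄ x₁ x₂ x₃ x₄ → ReachVals s w₁ w₂ w₃ w₄ x₁ x₂ x₃ y
      shift₄ y f p₁ p₂ p₃ p₄ R V@(vals v₁ v₂ v₃ v₄) = result , reaches ,
        vals (trans (rest n₁ ≢₁₄) v₁) (trans (rest n₂ ≢₂₄) v₂) (trans (rest n₃ ≢₃₄) v₃) at
        where open Shift (shift C R n₄ f (unused-vals Q V p₁ p₂ p₃ p₄))

      start-vals : ∀ {s} → SDR c s → ReachVals s w₁ w₂ w₃ w₄ (s w₁) (s w₂) (s w₃) (s w₄)
      start-vals R = _ , (R , agree (λ _ _ _ → refl)) , vals refl refl refl refl

      -- A three-cycle of colours, each step of which is blocked, is resolved by parking w₄:
      -- either w₄ takes over a colour of the cycle, or it takes an unused colour.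
      rotate-trade : ∀ {s} → SDR c s →
        Free c w₁ (s w₂) → Free c w₁ (s w₄) → Free c w₂ (s w₃) → Free c w₂ (s w₄) →
        Free c w₃ (s w₁) → Free c w₃ (s w₄) → Free c w₄ (s w₁) →
        ReachVals s w₁ w₂ w₃ w₄ (s w₂) (s w₃) (s w₁) (s w₄)
      rotate-trade R f₁₂ f₁₄ f₂₃ f₂₄ f₃₁ f₃₄ f₄₁ =
        start-vals R ⨾ trade₁₄ f₁₄ f₄₁ ⨾ trade₁₂ f₁₂ f₂₄ ⨾ trade₂₃ f₂₃ f₃₄ ⨾ trade₃₄ f₃₁ (free R n₄)

      rotate-shift : ∀ {s} → SDR c s →
        Free c w₁ (s w₂) → Free c w₁ (s w₄) → Free c w₂ (s w₃) → Free c w₂ (s w₄) →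
        Free c w₃ (s w₁) → Free c w₃ (s w₄) → ∀ r → Free c w₄ r → Unused s r →
        ReachVals s w₁ w₂ w₃ w₄ (s w₂) (s w₃) (s w₁) (s w₄)
      rotate-shift {s} R f₁₂ f₁₄ f₂₃ f₂₄ f₃₁ f₃₄ r f₄ un =
        -- Once `w₄` has moved to `r`, its old colour travels through `w₁`, `w₂`, `w₃` and home
        -- again. Each of these three takes its new colour when it gives up the travelling one.
        start-vals R
          ⨾ shift₄ r f₄ (un n₁) (un n₂) (un n₃) (un n₄)
          ⨾ shift₁ (s w₄) f₁₄ (≢₁₄ ∘ inj R n₁ n₄) (≢₂₄ ∘ inj R n₂ n₄) (≢₃₄ ∘ inj R n₃ n₄) (≢-sym (un n₄))
          ⨾ trade₁₂ f₁₂ f₂₄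
          ⨾ trade₂₃ f₂₃ f₃₄
          ⨾ shift₃ (s w₁) f₃₁ (≢-sym ≢₁₂ ∘ inj R n₂ n₁) (≢-sym ≢₁₃ ∘ inj R n₃ n₁)
              (≢-sym ≢₁₄ ∘ inj R n₄ n₁) (≢-sym (un n₁))
          ⨾ shift₄ (s w₄) (free R n₄) (≢₂₄ ∘ inj R n₂ n₄) (≢₃₄ ∘ inj R n₃ n₄)
              (≢₁₄ ∘ inj R n₁ n₄) (≢-sym (un n₄))

    module _ {s′ : Fin n → Fin k} (R′ : SDR c s′) where

      Progress : (Fin n → Fin k) → Set
      Progress s = ∃[ t ] (Reaches c s c t × (∀ {w} → N w → s w ≡ s′ w → t w ≡ s′ w) ×
        ∃[ w ] (N w × s w ≢ s′ w × t w ≡ s′ w))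

      record Blocked (s : Fin n → Fin k) (w v : Fin n) : Set where
        field
          nbr       : N v
          differs   : v ≢ w
          wanted    : s v ≡ s′ w
          not-free  : ¬ Free c v (s w)
          saturated : Saturated c s v

      -- The target `s′` uses this colour at `w` and hence not at `v`. So the holder is wrong as
      -- well, and moving it spoils nothing.
      wanted-wrong : ∀ {s : Fin n → Fin k} {w v} → N w → N v → s v ≡ s′ w → s w ≢ s′ w → s v ≢ s′ v
      wanted-wrong Nw Nv q d e with inj R′ Nw Nv (trans (≡-sym q) e)
      ... | refl = d q

      attempt : ∀ {s w} → SDR c s → N w → s w ≢ s′ w → Progress s ⊎ ∃[ v ] Blocked s w v
      attempt {s} {w} R Nw d with used? s (s′ w)
      ... | inj₂ un = inj₁ (result , reaches ,
          (λ Nz e → trans (rest Nz λ { refl → d e }) e) , w , Nw , d , at)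
        where open Shift (shift C R Nw (free R′ Nw) un)
      ... | inj₁ (v , Nv , q) with free? c v (s w)
      ...   | yes f = inj₁ (result , reaches ,
          (λ Nz e → trans (rest Nz (λ { refl → d e }) (λ { refl → wanted-wrong Nw Nv q d e })) e) ,
          w , Nw , d , trans at₁ q)
        where open Trade (trade C R Nw Nv refl refl (subst (Free c w) (≡-sym q) (free R′ Nw)) f)
      ...   | no nf with saturated? c s v
      ...     | inj₂ sat = inj₂ (v , record
          { nbr = Nv ; differs = λ { refl → d q } ; wanted = q ; not-free = nf ; saturated = sat })
      ...     | inj₁ (r , f , un) = inj₁ (S₂.result , reaches-trans {c = c} S₁.reaches S₂.reaches ,
          (λ Nz e → trans (S₂.rest Nz λ { refl → d e })
            (trans (S₁.rest Nz (λ { refl → wanted-wrong Nw Nv q d e })) e)) ,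
          w , Nw , d , S₂.at)
        where
          module S₁ = Shift (shift C R Nv f un)
          unused : Unused S₁.result (s′ w)
          unused {z} Nz e with z ≟ v
          ... | yes refl = un Nv (trans q (trans (≡-sym e) S₁.at))
          ... | no z≢v = z≢v (inj R Nz Nv (trans (≡-sym (S₁.rest Nz z≢v)) (trans e (≡-sym q))))
          module S₂ = Shift (shift C (proj₁ S₁.reaches) Nw (free R′ Nw) unused)

      module _ {s w₁ w₂ w₃ w₄} (R : SDR c s) (Q : Quad w₁ w₂ w₃ w₄) (d₁ : s w₁ ≢ s′ w₁)
        (B₂ : Blocked s w₁ w₂) (B₃ : Blocked s w₂ w₃) (f₂₄ : Free c w₂ (s w₄)) where

        open Quad Q renaming (n₁ to N₁; n₂ to N₂; n₃ to N₃; n₄ to N₄)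
        d₂ = wanted-wrong N₁ N₂ (Blocked.wanted B₂) d₁
        d₃ = wanted-wrong N₂ N₃ (Blocked.wanted B₃) d₂

        f₁₂ : Free c w₁ (s w₂)
        f₁₂ = subst (Free c w₁) (≡-sym (Blocked.wanted B₂)) (free R′ N₁)
        f₂₃ : Free c w₂ (s w₃)
        f₂₃ = subst (Free c w₂) (≡-sym (Blocked.wanted B₃)) (free R′ N₂)
        -- At least three colours are free at `w₃`. All of them occur at `u`, but the colour of `w₂`
        -- is not one of them, so they are exactly those of `w₁`, `w₃` and `w₄`.
        f₃₄ : Free c w₃ (s w₄)
        f₃₄ with pick c N₃ (s w₃) (s w₁)
        ... | r , f , r≢₃ , r≢₁ with Blocked.saturated B₃ f
        ...   | z , Nz , refl with among Q Nz
        ...     | is₁ = contradiction refl r≢₁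
        ...     | is₂ = contradiction f (Blocked.not-free B₃)
        ...     | is₃ = contradiction refl r≢₃
        ...     | is₄ = f
        f₃₁ : Free c w₃ (s w₁)
        f₃₁ with pick c N₃ (s w₃) (s w₄)
        ... | r , f , r≢₃ , r≢₄ with Blocked.saturated B₃ f
        ...   | z , Nz , refl with among Q Nz
        ...     | is₁ = f
        ...     | is₂ = contradiction f (Blocked.not-free B₃)
        ...     | is₃ = contradiction refl r≢₃
        ...     | is₄ = contradiction refl r≢₄

        conclude : ∀ {x₄} → ReachVals s w₁ w₂ w₃ w₄ (s w₂) (s w₃) (s′ w₃) x₄ →
          (s w₄ ≡ s′ w₄ → x₄ ≡ s′ w₄) → Progress s
        conclude (t , r , vals v₁ v₂ v₃ v₄) k₄ = t , r , keep , w₁ , N₁ , d₁ , trans v₁ (Blocked.wanted B₂)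
          where
            keep : ∀ {w} → N w → s w ≡ s′ w → t w ≡ s′ w
            keep Nw e with among Q Nw
            ... | is₁ = trans v₁ (Blocked.wanted B₂)
            ... | is₂ = trans v₂ (Blocked.wanted B₃)
            ... | is₃ = v₃
            ... | is₄ = trans v₄ (k₄ e)

        three-cycle : Blocked s w₃ w₁ → Progress s
        three-cycle B₁ = conclude (subst (λ x → ReachVals s w₁ w₂ w₃ w₄ (s w₂) (s w₃) x (s w₄))
            (Blocked.wanted B₁) rotated) (λ e → e)
          where
            f₁₄ : Free c w₁ (s w₄)
            f₁₄ with pick c N₁ (s w₁) (s w₂)
            ... | r , f , r≢₁ , r≢₂ with Blocked.saturated B₁ f
            ...   | z , Nz , refl with among Q Nz
            ...     | is₁ = contradiction refl r≢₁
            ...     | is₂ = contradiction refl r≢₂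
            ...     | is₃ = contradiction f (Blocked.not-free B₁)
            ...     | is₄ = f
            unrotate : ∀ {a b d x₁ x₂ x₃ x₄} → ReachVals s b d a w₄ x₂ x₃ x₁ x₄ → ReachVals s a b d w₄ x₁ x₂ x₃ x₄
            unrotate (t , r , vals v₂ v₃ v₁ v₄) = t , r , vals v₁ v₂ v₃ v₄
            rotated : ReachVals s w₁ w₂ w₃ w₄ (s w₂) (s w₃) (s w₁) (s w₄)
            rotated with pick c N₄ (s w₄) (s w₄)
            ... | r , f , r≢₄ , _ with used? s r
            ...   | inj₂ un = rotate-shift Q R f₁₂ f₁₄ f₂₃ f₂₄ f₃₁ f₃₄ r f un
            ...   | inj₁ (z , Nz , refl) with among Q Nz
            ...     | is₁ = rotate-trade Q R f₁₂ f₁₄ f₂₃ f₂₄ f₃₁ f₃₄ f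
            ...     | is₂ = unrotate (rotate-trade (rotate-quad Q) R f₂₃ f₂₄ f₃₁ f₃₄ f₁₂ f₁₄ f)
            ...     | is₃ = unrotate (unrotate
                (rotate-trade (rotate-quad (rotate-quad Q)) R f₃₁ f₃₄ f₁₂ f₁₄ f₂₃ f₂₄ f))
            ...     | is₄ = contradiction refl r≢₄

        finish : Progress s ⊎ (∃[ v ] Blocked s w₃ v) → Progress s
        finish (inj₁ p) = p
        finish (inj₂ (v , B)) with among Q (Blocked.nbr B)
        ... | is₁ = three-cycle B
        ... | is₂ = contradiction (inj R′ N₁ N₃ (trans (≡-sym (Blocked.wanted B₂)) (Blocked.wanted B))) ≢₁₃
        ... | is₃ = contradiction (Blocked.wanted B) d₃
        -- The wanted colours form a chain from `w₁` to `w₄`. Three trades move the colours one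
        -- place along it, and `w₄`, which was wrong anyway, ends up with the old colour of `w₁`.
        ... | is₄ = conclude
            (subst (λ x → ReachVals s w₁ w₂ w₃ w₄ (s w₂) (s w₃) x (s w₁)) (Blocked.wanted B)
              (start-vals Q R ⨾ trade₂₄ Q f₂₄ f₄₂ ⨾ trade₁₄ Q f₁₂ f₄₁ ⨾ trade₂₃ Q f₂₃ f₃₄))
            (λ e → contradiction e (wanted-wrong N₃ N₄ (Blocked.wanted B) d₃))
          where
            f₄₂ : Free c w₄ (s w₂)
            f₄₂ with pick c N₄ (s w₄) (s w₁)
            ... | r , f , r≢₄ , r≢₁ with Blocked.saturated B f
            ...   | z , Nz , refl with among Q Nz
            ...     | is₁ = contradiction refl r≢₁
            ...     | is₂ = f
            ...     | is₃ = contradiction f (Blocked.not-free B)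
            ...     | is₄ = contradiction refl r≢₄
            f₄₁ : Free c w₄ (s w₁)
            f₄₁ with pick c N₄ (s w₄) (s w₂)
            ... | r , f , r≢₄ , r≢₂ with Blocked.saturated B f
            ...   | z , Nz , refl with among Q Nz
            ...     | is₁ = f
            ...     | is₂ = contradiction refl r≢₂
            ...     | is₃ = contradiction f (Blocked.not-free B)
            ...     | is₄ = contradiction refl r≢₄

      -- Three blocked attempts in a row involve all four neighbours and almost determine
      -- the sets of free colours.
      advance : ∀ {s w} → SDR c s → N w → s w ≢ s′ w → Progress s
      advance {s} {w₁} R N₁ d₁ with attempt R N₁ d₁
      ... | inj₁ p = p
      ... | inj₂ (w₂ , B₂) with attempt R (Blocked.nbr B₂) (wanted-wrong N₁ (Blocked.nbr B₂) (Blocked.wanted B₂) d₁)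
      ...   | inj₁ p = p
      ...   | inj₂ (w₃ , B₃) with pick c (Blocked.nbr B₂) (s w₂) (s w₃)
      ...     | t , f , t≢₂ , t≢₃ with Blocked.saturated B₂ f
      ...       | w₄ , N₄ , refl = finish R Q d₁ B₂ B₃ f (attempt R N₃ (d₃ R Q d₁ B₂ B₃ f))
        where
          N₂ = Blocked.nbr B₂
          N₃ = Blocked.nbr B₃
          Q : Quad w₁ w₂ w₃ w₄
          Q = record
            { n₁ = N₁ ; n₂ = N₂ ; n₃ = N₃ ; n₄ = N₄
            ; ≢₁₂ = ≢-sym (Blocked.differs B₂)
            ; ≢₁₃ = λ { refl → Blocked.not-free B₂ (subst (Free c w₂) (≡-sym (Blocked.wanted B₃)) (free R′ N₂)) }
            ; ≢₁₄ = λ { refl → Blocked.not-free B₂ f }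
            ; ≢₂₃ = ≢-sym (Blocked.differs B₃)
            ; ≢₂₄ = λ { refl → t≢₂ refl }
            ; ≢₃₄ = λ { refl → t≢₃ refl }
            }

      wrong? : ∀ (s : Fin n → Fin k) w → Dec (s w ≢ s′ w)
      wrong? s w = ¬? (s w ≟ s′ w)

      wrong : (Fin n → Fin k) → ℕ
      wrong s = length (filter (wrong? s) (neighbours G u))

      same-class : ∀ m {s} → wrong s < m → SDR c s → G ⊢ join c s ~ join c s′
      same-class (suc m) {s} (s≤s le) R with any? (λ w → adj? G u w ×-dec wrong? s w)
      ... | no all = agree (join-resp (λ _ _ _ → refl)
          (λ {w} Nw → decidable-stable (s w ≟ s′ w) (λ d → all (w , Nw , d))))
      ... | yes (w , Nw , d) with advance R Nw d
      ...   | t , (T , p) , keep , v , Nv , dv , ev = ~-trans p (same-class m (ℕ.≤-trans fewer le) T)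
        where
          fewer : wrong t < wrong s
          fewer = unique-subset-length {xs = v ∷ filter (wrong? t) (neighbours G u)}
            (All.tabulate (λ x∈ e → proj₂ (∈-filter⁻ (wrong? t) {xs = neighbours G u} x∈) (subst (λ x → t x ≡ s′ x) e ev)) ∷
              filter⁺ (wrong? t) (neighbours-unique G u)) ⊆
            where
              ⊆ : ∀ {x} → x ∈ v ∷ filter (wrong? t) (neighbours G u) → x ∈ filter (wrong? s) (neighbours G u)
              ⊆ (here refl) = ∈-filter⁺ (wrong? s) (∈-neighbours G Nv) dv
              ⊆ (there x∈) with ∈-filter⁻ (wrong? t) {xs = neighbours G u} x∈
              ... | x∈N , tx = ∈-filter⁺ (wrong? s) x∈N (λ e → tx (keep (∈-neighbours⁻ G x∈N) e))

  unique-extension : ∀ {c s s′} → IsEdgeColouring H k c → SDR c s → SDR c s′ → G ⊢ join c s ~ join c s′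
  unique-extension C R R′ = SameColouring.same-class C R′ _ (ℕ.n<1+n _) R

  -- A switch of `G − u` lifts when both colourings extend

  lift-adjusted : ∀ {c s a b K w} γ β → IsEdgeColouring H k c → SDR c s → Closed H c a b K →
    Free c w a → Free c w b →
    (∀ {v} → N v → OneOf a b (s v) → (v ≡ w → γ ≡ β) × (v ≢ w → K v ≡ β)) →
    ∃[ t ] Reaches c s (interchange K a b c) t
  lift-adjusted {c} {s} {a} {b} {K} {w} γ β C R cl fa fb side =
    t , sdr-resp agrees T , ~-trans p (agree (join-resp agrees (λ _ → refl)))
    where
      -- With both colours free at `w`, no edge of the (a,b)-subgraph of `H` meets `w`. Its side may
      -- be chosen at will, without effect on the edges of `H`.
      K′ : Fin n → Bool
      K′ x = if does (x ≟ w) then γ else K x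
      K′-other : ∀ {x} → x ≢ w → K′ x ≡ K x
      K′-other {x} p rewrite dec-false (x ≟ w) p = refl
      avoids : ∀ {v} → Adj H w v → ¬ OneOf a b (c w v)
      avoids e (inj₁ p) = fa _ e p
      avoids e (inj₂ p) = fb _ e p
      cl′ : Closed H c a b K′
      bi⇒≡ cl′ x y r with x ≟ w
      ... | yes refl = contradiction (proj₂ r) (avoids (proj₁ r))
      ... | no _ with y ≟ w
      ...   | yes refl with bi-sym {G = H} C r
      ...     | e , o = contradiction o (avoids e)
      bi⇒≡ cl′ x y r | no _ | no _ = bi⇒≡ cl x y r
      agrees : Agree H (interchange K′ a b c) (interchange K a b c)
      agrees x y e = by-cases (x ≟ w)
        where
          by-cases : Dec (x ≡ w) → interchange K′ a b c x y ≡ interchange K a b c x y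
          by-cases (yes refl) = trans (interchange-other K′ c x y (avoids e)) (≡-sym (interchange-other K c x y (avoids e)))
          by-cases (no p) = cong (λ β → if β then swap a b (c x y) else c x y) (K′-other p)
      side′ : ∀ {v} → N v → OneOf a b (s v) → K′ v ≡ β
      side′ {v} Nv o with v ≟ w
      ... | yes p = proj₁ (side Nv o) p
      ... | no p = proj₂ (side Nv o) p
      lifted = lift β C R cl′ side′
      t = proj₁ lifted
      T = proj₁ (proj₂ lifted)
      p = proj₂ (proj₂ lifted)

  module Transfer {c : Assignment n k} {a b : Fin k} {K : Fin n → Bool} {s′ : Fin n → Fin k}
    (C : IsEdgeColouring H k c) (cl : Closed H c a b K) (R′ : SDR (interchange K a b c) s′) where

    open SameColouring C

    c′ : Assignment n k
    c′ = interchange K a b c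

    -- Which extension is reached does not matter, since `unique-extension` leads on from it to
    -- `s′`.
    Goal : (Fin n → Fin k) → Set
    Goal s = ∃[ t ] Reaches c s (interchange K a b c) t

    after : ∀ {s t} → Reaches c s c t → Goal t → Goal s
    after r (t′ , r′) = t′ , reaches-trans r r′

    free-other : ∀ {w t} → t ≢ a → t ≢ b → Free (interchange K a b c) w t → Free c w t
    free-other {w} p q f v e refl = f v e (interchange-other K c w v [ p , q ])

    free-in : ∀ {w} → K w ≡ true → Free (interchange K a b c) w a → Free c w b
    free-in {w} i f v e p = f v e (trans (interchange-in K a b c v i) (trans (cong (swap a b) p) (swap-second a b)))

    free-out : ∀ {w} → K w ≡ false → Free (interchange K a b c) w a → Free c w a
    free-out {w} i f v e p = f v e (trans (interchange-out K a b c v i) p)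

    lift-vals : ∀ {s w₁ w₂ w₃ w₄ x₁ x₂ x₃ x₄} β → Quad w₁ w₂ w₃ w₄ →
      (OneOf a b x₁ → K w₁ ≡ β) → (OneOf a b x₂ → K w₂ ≡ β) →
      (OneOf a b x₃ → K w₃ ≡ β) → (OneOf a b x₄ → K w₄ ≡ β) →
      ReachVals s w₁ w₂ w₃ w₄ x₁ x₂ x₃ x₄ → Goal s
    lift-vals β Q h₁ h₂ h₃ h₄ (t , r , vals v₁ v₂ v₃ v₄) = after r (lift β C (proj₁ r) cl side)
      where
        side : ∀ {w} → N w → OneOf a b (t w) → K w ≡ β
        side Nw o with among Q Nw
        ... | is₁ = h₁ (subst (OneOf a b) v₁ o)
        ... | is₂ = h₂ (subst (OneOf a b) v₂ o)
        ... | is₃ = h₃ (subst (OneOf a b) v₃ o)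
        ... | is₄ = h₄ (subst (OneOf a b) v₄ o)

    module _ {s w₁ w₂ w₃ w₄ p q} (R : SDR c s) (Q : Quad w₁ w₂ w₃ w₄) (V : Vals s w₁ w₂ w₃ w₄ a b p q)
      (in₁ : K w₁ ≡ true) (out₂ : K w₂ ≡ false) (f₁p : Free c w₁ p) (f₂p : Free c w₂ p) where

      open Quad Q
      open Vals V

      p∉ : ¬ OneOf a b p
      p∉ = [ (λ e → ≢₁₃ (inj R n₁ n₃ (trans v₁ (trans (≡-sym e) (≡-sym v₃)))))
           , (λ e → ≢₂₃ (inj R n₂ n₃ (trans v₂ (trans (≡-sym e) (≡-sym v₃))))) ]
      q∉ : ¬ OneOf a b q
      q∉ = [ (λ e → ≢₁₄ (inj R n₁ n₄ (trans v₁ (trans (≡-sym e) (≡-sym v₄)))))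
           , (λ e → ≢₂₄ (inj R n₂ n₄ (trans v₂ (trans (≡-sym e) (≡-sym v₄))))) ]

      -- The colour `s′ w₃` suggests a move. If it is `a`, then `w₃` can take over `b` from `w₂`
      -- when it lies inside `K`, or `a` from `w₁` when it lies outside, and both colours then lead
      -- to one side. If it is none of `a`, `b`, `p`, `q`, then `w₃` takes it and `w₁` takes `p`, so
      -- that `a` disappears from `u`.
      third : ∀ {xs} → b ∈ xs → p ∈ xs → q ∈ xs → Goal s ⊎ s′ w₃ ∈ xs
      third b∈ p∈ q∈ with s′ w₃ ≟ b | s′ w₃ ≟ p | s′ w₃ ≟ q | s′ w₃ ≟ a | K w₃ in Kw₃
      ... | yes e | _ | _ | _ | _ = inj₂ (subst (_∈ _) (≡-sym e) b∈)
      ... | no _ | yes e | _ | _ | _ = inj₂ (subst (_∈ _) (≡-sym e) p∈)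
      ... | no _ | no _ | yes e | _ | _ = inj₂ (subst (_∈ _) (≡-sym e) q∈)
      ... | no _ | no _ | no _ | yes e | true = inj₁ (lift-vals true Q (λ _ → in₁) (⊥-elim ∘ p∉) (λ _ → Kw₃) (⊥-elim ∘ q∉)
          (trade₂₃ Q f₂p (free-in Kw₃ (subst (Free c′ w₃) e (free R′ n₃))) R V))
      ... | no _ | no _ | no _ | yes e | false = inj₁ (lift-vals false Q (⊥-elim ∘ p∉) (λ _ → out₂) (λ _ → Kw₃) (⊥-elim ∘ q∉)
          (trade₁₃ Q f₁p (free-out Kw₃ (subst (Free c′ w₃) e (free R′ n₃))) R V))
      ... | no t≢b | no t≢p | no t≢q | no t≢a | _ = inj₁ (lift-vals false Q
          (⊥-elim ∘ p∉) (λ _ → out₂) (⊥-elim ∘ [ t≢a , t≢b ]) (⊥-elim ∘ q∉)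
          (shift₃ Q (s′ w₃) (free-other t≢a t≢b (free R′ n₃)) (≢-sym t≢a) (≢-sym t≢b) (≢-sym t≢p) (≢-sym t≢q) R V
            ⨾ shift₁ Q p f₁p (p∉ ∘ inj₁ ∘ ≡-sym) (p∉ ∘ inj₂ ∘ ≡-sym) t≢p
                (λ e → ≢₃₄ (inj R n₃ n₄ (trans v₃ (trans (≡-sym e) (≡-sym v₄)))))))

    -- p and q are the colours of the two remaining edges at u. If no move made the lift
    -- possible, then s′ would give the four edges three colours b, p, q only.
    stuck₄ : ∀ {s w₁ w₂ w₃ w₄ p q} → SDR c s → Quad w₁ w₂ w₃ w₄ → Vals s w₁ w₂ w₃ w₄ a b p q →
      K w₁ ≡ true → K w₂ ≡ false → ¬ Free c w₁ b → ¬ Free c w₂ a →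
      Saturated c s w₁ → Saturated c s w₂ →
      Free c w₁ p → Free c w₁ q → Free c w₂ p → Free c w₂ q → Goal s
    stuck₄ {s} {w₁} {w₂} {w₃} {w₄} {p} {q} R Q V in₁ out₂ nf₁ nf₂ sat₁ sat₂ f₁p f₁q f₂p f₂q
      with third R Q V in₁ out₂ f₁p f₂p {xs = b ∷ p ∷ q ∷ []} (here refl) (there (here refl)) (there (there (here refl)))
         | third R Q′ V′ in₁ out₂ f₁q f₂q {xs = b ∷ p ∷ q ∷ []} (here refl) (there (there (here refl))) (there (here refl))
      where
        open Quad Q
        open Vals V
        Q′ : Quad w₁ w₂ w₄ w₃
        Q′ = record { n₁ = n₁ ; n₂ = n₂ ; n₃ = n₄ ; n₄ = n₃ ; ≢₁₂ = ≢₁₂ ; ≢₁₃ = ≢₁₄ ; ≢₁₄ = ≢₁₃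
                    ; ≢₂₃ = ≢₂₄ ; ≢₂₄ = ≢₂₃ ; ≢₃₄ = ≢-sym ≢₃₄ }
        V′ : Vals s w₁ w₂ w₄ w₃ a b q p
        V′ = vals v₁ v₂ v₄ v₃
    ... | inj₁ g | _ = g
    ... | inj₂ _ | inj₁ g = g
    ... | inj₂ t₃∈ | inj₂ t₄∈ = contradiction (unique-subset-length distinct ⊆) (ℕ.<⇒≱ (ℕ.n<1+n 3))
      where
        open Quad Q
        open Vals V
        -- This is applied to `w₁` and `w₂`. There `a` is not free after the interchange, as
        -- otherwise `b` at `w₁` or `a` at `w₂` would have been free before; colours other than `a`
        -- and `b` are untouched, so saturation finds them at `u`.
        taken : ∀ {w} → N w → Saturated c s w →
          ¬ Free c′ w a → s′ w ∈ b ∷ p ∷ q ∷ []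
        taken {w} Nw sat nf with s′ w ≟ b | s′ w ≟ a
        ... | yes e | _ = here e
        ... | no _ | yes e = contradiction (subst (Free c′ w) e (free R′ Nw)) nf
        ... | no t≢b | no t≢a with sat (free-other t≢a t≢b (free R′ Nw))
        ...   | z , Nz , e with among Q Nz
        ...     | is₁ = contradiction (trans (≡-sym e) v₁) t≢a
        ...     | is₂ = contradiction (trans (≡-sym e) v₂) t≢b
        ...     | is₃ = there (here (trans (≡-sym e) v₃))
        ...     | is₄ = there (there (here (trans (≡-sym e) v₄)))
        ⊆ : ∀ {x} → x ∈ s′ w₁ ∷ s′ w₂ ∷ s′ w₃ ∷ s′ w₄ ∷ [] → x ∈ b ∷ p ∷ q ∷ []
        ⊆ (here refl) = taken n₁ sat₁ (nf₁ ∘ free-in in₁)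
        ⊆ (there (here refl)) = taken n₂ sat₂ (nf₂ ∘ free-out out₂)
        ⊆ (there (there (here refl))) = t₃∈
        ⊆ (there (there (there (here refl)))) = t₄∈
        distinct : Unique (s′ w₁ ∷ s′ w₂ ∷ s′ w₃ ∷ s′ w₄ ∷ [])
        distinct = ((≢₁₂ ∘ inj R′ n₁ n₂) ∷ (≢₁₃ ∘ inj R′ n₁ n₃) ∷ (≢₁₄ ∘ inj R′ n₁ n₄) ∷ []) ∷
          ((≢₂₃ ∘ inj R′ n₂ n₃) ∷ (≢₂₄ ∘ inj R′ n₂ n₄) ∷ []) ∷ ((≢₃₄ ∘ inj R′ n₃ n₄) ∷ []) ∷ [] ∷ []

    stuck : ∀ {s w₁ w₂} → SDR c s → N w₁ → N w₂ → K w₁ ≡ true → K w₂ ≡ false →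
      s w₁ ≡ a → s w₂ ≡ b → Goal s
    stuck {s} {w₁} {w₂} R N₁ N₂ in₁ out₂ e₁ e₂ = go (free? c w₁ b) (free? c w₂ a)
      where
        w₁≢w₂ : w₁ ≢ w₂
        w₁≢w₂ refl with trans (≡-sym in₁) out₂
        ... | ()
        only : ∀ {v} → N v → OneOf a b (s v) → v ≡ w₁ ⊎ v ≡ w₂
        only Nv (inj₁ e) = inj₁ (inj R Nv N₁ (trans e (≡-sym e₁)))
        only Nv (inj₂ e) = inj₂ (inj R Nv N₂ (trans e (≡-sym e₂)))
        shift-side : ∀ {w r v t} → N v → (∀ {z} → N z → s z ≢ r) → t w ≡ r → (∀ {z} → N z → z ≢ w → t z ≡ s z) →
          OneOf a b (t v) → v ≢ w × (v ≡ w₁ ⊎ v ≡ w₂)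
        shift-side {w} {r} {v} {t} Nv un at rest o with v ≟ w
        ... | yes refl = ⊥-elim ([ (λ e → un N₁ (trans e₁ (trans (≡-sym e) at)))
                                 , (λ e → un N₂ (trans e₂ (trans (≡-sym e) at))) ] o)
        ... | no v≢w = v≢w , only Nv (subst (OneOf a b) (rest Nv v≢w) o)
        go : Dec (Free c w₁ b) → Dec (Free c w₂ a) → Goal s
        go (yes f) _ = lift-adjusted {w = w₁} false false C R cl (subst (Free c w₁) e₁ (free R N₁)) f
          (λ Nv o → (λ _ → refl) , λ v≢w₁ → [ (λ v≡w₁ → contradiction v≡w₁ v≢w₁) , (λ { refl → out₂ }) ] (only Nv o))
        go (no _) (yes f) = lift-adjusted {w = w₂} true true C R cl f (subst (Free c w₂) e₂ (free R N₂))
          (λ Nv o → (λ _ → refl) , λ v≢w₂ → [ (λ { refl → in₁ }) , (λ v≡w₂ → contradiction v≡w₂ v≢w₂) ] (only Nv o))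
        go (no nf₁) (no nf₂) with saturated? c s w₁ | saturated? c s w₂
        ... | inj₁ (r , f , un) | _ = after reaches (lift false C (proj₁ reaches) cl side)
          where
            open Shift (shift C R N₁ f un)
            side : ∀ {v} → N v → OneOf a b (result v) → K v ≡ false
            side Nv o with shift-side {t = result} Nv un at rest o
            ... | v≢w₁ , inj₁ refl = contradiction refl v≢w₁
            ... | _ , inj₂ refl = out₂
        ... | inj₂ _ | inj₁ (r , f , un) = after reaches (lift true C (proj₁ reaches) cl side)
          where
            open Shift (shift C R N₂ f un)
            side : ∀ {v} → N v → OneOf a b (result v) → K v ≡ true
            side Nv o with shift-side {t = result} Nv un at rest o
            ... | _ , inj₁ refl = in₁
            ... | v≢w₂ , inj₂ refl = contradiction refl v≢w₂
        ... | inj₂ sat₁ | inj₂ sat₂ with pick c N₁ a a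
        ...   | p , f₁p , p≢a , _ with pick c N₁ a p | sat₁ f₁p
        ...     | q , f₁q , q≢a , q≢p | w₃ , N₃ , e₃ with sat₁ f₁q
        ...       | w₄ , N₄ , e₄ = stuck₄ R Q (vals e₁ e₂ e₃ e₄) in₁ out₂ nf₁ nf₂ sat₁ sat₂ f₁p f₁q f₂p f₂q
          where
            Q : Quad w₁ w₂ w₃ w₄
            Q = record
              { n₁ = N₁ ; n₂ = N₂ ; n₃ = N₃ ; n₄ = N₄
              ; ≢₁₂ = w₁≢w₂
              ; ≢₁₃ = λ { refl → p≢a (trans (≡-sym e₃) e₁) }
              ; ≢₁₄ = λ { refl → q≢a (trans (≡-sym e₄) e₁) }
              ; ≢₂₃ = λ { refl → nf₁ (subst (Free c w₁) (trans (≡-sym e₃) e₂) f₁p) }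
              ; ≢₂₄ = λ { refl → nf₁ (subst (Free c w₁) (trans (≡-sym e₄) e₂) f₁q) }
              ; ≢₃₄ = λ { refl → q≢p (trans (≡-sym e₄) e₃) }
              }
            -- Three colours free at `w₂` all occur at `u`, and `a` is not among them, so they are
            -- `b`, `p` and `q`.
            f₂p : Free c w₂ p
            f₂p with pick c N₂ b q
            ... | r , f , r≢b , r≢q with sat₂ f
            ...   | z , Nz , refl with among Q Nz
            ...     | is₁ = contradiction (subst (Free c w₂) e₁ f) nf₂
            ...     | is₂ = contradiction e₂ r≢b
            ...     | is₃ = subst (Free c w₂) e₃ f
            ...     | is₄ = contradiction e₄ r≢q
            f₂q : Free c w₂ q
            f₂q with pick c N₂ b p
            ... | r , f , r≢b , r≢p with sat₂ f
            ...   | z , Nz , refl with among Q Nz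
            ...     | is₁ = contradiction (subst (Free c w₂) e₁ f) nf₂
            ...     | is₂ = contradiction e₂ r≢b
            ...     | is₃ = contradiction e₃ r≢p
            ...     | is₄ = subst (Free c w₂) e₄ f

  closed-comm : ∀ {c : Assignment n k} {a b K} → Closed H c a b K → Closed H c b a K
  bi⇒≡ (closed-comm cl) x y (e , o) = bi⇒≡ cl x y (e , [ inj₂ , inj₁ ] o)

  interchange-comm : ∀ (K : Fin n → Bool) a b (c : Assignment n k) x y →
    interchange K a b c x y ≡ interchange K b a c x y
  interchange-comm K a b c x y = cong (λ t → if K x then t else c x y) (swap-comm a b (c x y))

  -- If the edges at `u` coloured `a` or `b` all lead to one side of `K`, then `u` joins that side.
  -- If not, there are exactly two such edges, of different colours and leading to different sides,
  -- which is the case of `stuck`.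
  transfer : ∀ {c a b K s s′} → IsEdgeColouring H k c → Closed H c a b K →
    SDR c s → SDR (interchange K a b c) s′ → G ⊢ join c s ~ join (interchange K a b c) s′
  transfer {c} {a} {b} {K} {s} {s′} C cl R R′ = finish goal
    where
      open Transfer C cl R′ using (Goal)
      finish : Goal s → G ⊢ join c s ~ join (interchange K a b c) s′
      finish (t , T , p) = ~-trans p (unique-extension (interchange-colouring cl C) T R′)
      ends? : ∀ β → (∃[ w ] ((N w × OneOf a b (s w)) × K w ≡ β)) ⊎ (∀ {w} → N w → OneOf a b (s w) → K w ≡ not β)
      ends? β with any? (λ w → (adj? G u w ×-dec oneOf? a b (s w)) ×-dec (K w Bool.≟ β))
      ... | yes p = inj₁ p
      ... | no ¬p = inj₂ (λ Nw o → Bool.¬-not (λ e → ¬p (_ , (Nw , o) , e)))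
      commuted : Agree H (interchange K a b c) (interchange K b a c)
      commuted x y _ = interchange-comm K a b c x y
      goal : Goal s
      goal with ends? true | ends? false
      ... | inj₂ h | _ = lift false C R cl h
      ... | inj₁ _ | inj₂ h = lift true C R cl h
      ... | inj₁ (w₁ , (N₁ , inj₁ e₁) , in₁) | inj₁ (w₂ , (N₂ , inj₂ e₂) , out₂) =
        Transfer.stuck C cl R′ R N₁ N₂ in₁ out₂ e₁ e₂
      ... | inj₁ (w₁ , (N₁ , inj₂ e₁) , in₁) | inj₁ (w₂ , (N₂ , inj₁ e₂) , out₂)
        -- `stuck` expects `a` on the inner side, so the two colours exchange their names.
        with Transfer.stuck C (closed-comm cl) (sdr-resp commuted R′) R N₁ N₂ in₁ out₂ e₁ e₂
      ...   | t , T , p = t , sdr-resp (agree-sym H commuted) T ,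
          ~-trans p (agree (join-resp (agree-sym H commuted) (λ _ → refl)))
      goal | inj₁ (w₁ , (N₁ , inj₁ e₁) , in₁) | inj₁ (w₂ , (N₂ , inj₁ e₂) , out₂)
        with inj R N₁ N₂ (trans e₁ (≡-sym e₂))
      ...   | refl with trans (≡-sym in₁) out₂
      ...     | ()
      goal | inj₁ (w₁ , (N₁ , inj₂ e₁) , in₁) | inj₁ (w₂ , (N₂ , inj₂ e₂) , out₂)
        with inj R N₁ N₂ (trans e₁ (≡-sym e₂))
      ...   | refl with trans (≡-sym in₁) out₂
      ...     | ()

  -- Colourings that do not extend

  free-interchange⁺ : ∀ S c {a b w t} → t ≢ a → t ≢ b → Free c w t → Free (interchange S a b c) w t
  free-interchange⁺ S c {a} {b} {w} p q f v e r with oneOf? a b (c w v)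
  ... | yes o = [ (λ r′ → p (trans (≡-sym r) r′)) , (λ r′ → q (trans (≡-sym r) r′)) ] (interchange-oneOf S c w v o)
  ... | no ¬o = f v e (trans (≡-sym (interchange-other S c w v ¬o)) r)

  free-interchange⁻ : ∀ S c {a b w t} → t ≢ a → t ≢ b → Free (interchange S a b c) w t → Free c w t
  free-interchange⁻ S c {w = w} p q f v e refl = f v e (interchange-other S c w v [ p , q ])

  PartialSDR : Assignment n k → List (Fin n) → (Fin n → Fin k) → Set
  PartialSDR c ws s = (∀ {w} → w ∈ ws → Free c w (s w)) ×
    (∀ {w w′} → w ∈ ws → w′ ∈ ws → s w ≡ s w′ → w ≡ w′)

  update : (Fin n → Fin k) → Fin n → Fin k → Fin n → Fin k
  update s w t x = if does (x ≟ w) then t else s x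

  update-at : ∀ s w t → update s w t w ≡ t
  update-at s w t rewrite dec-true (w ≟ w) refl = refl

  update-other : ∀ s {w x} t → x ≢ w → update s w t x ≡ s x
  update-other s {w} {x} t p rewrite dec-false (x ≟ w) p = refl

  -- The list may already contain `w`, whose old value is then overwritten; hence the new colour is
  -- compared with the values at other vertices only.
  partial-update : ∀ {c ws s w t} → PartialSDR c ws s → Free c w t →
    (∀ {v} → v ∈ ws → v ≢ w → s v ≢ t) → PartialSDR c (w ∷ ws) (update s w t)
  partial-update {c} {ws} {s} {w} {t} (f , i) ft new = free′ , λ v∈ z∈ → inj′ v∈ z∈
    where
      old : ∀ {v} → v ∈ w ∷ ws → v ≢ w → v ∈ ws
      old (here p) v≢w = contradiction p v≢w
      old (there v∈) _ = v∈
      free′ : ∀ {v} → v ∈ w ∷ ws → Free c v (update s w t v)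
      free′ {v} v∈ with v ≟ w
      ... | yes refl = ft
      ... | no v≢w = f (old v∈ v≢w)
      inj′ : ∀ {v z} → v ∈ w ∷ ws → z ∈ w ∷ ws → update s w t v ≡ update s w t z → v ≡ z
      inj′ {v} {z} v∈ z∈ q with v ≟ w | z ≟ w
      ... | yes refl | yes refl = refl
      ... | yes refl | no z≢w = contradiction (≡-sym q) (new (old z∈ z≢w) z≢w)
      ... | no v≢w | yes refl = contradiction q (new (old v∈ v≢w) v≢w)
      ... | no v≢w | no z≢w = i (old v∈ v≢w) (old z∈ z≢w) q

  -- When a neighbour chooses, at most two colours are taken, and `pick` can avoid two.
  greedy : ∀ c ws → All N ws → length ws ≤ 3 → ∃[ s ] PartialSDR c ws s
  greedy c [] [] _ = (λ _ → c u u) , (λ ()) , (λ ())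
  greedy c (w ∷ ws) (Nw ∷ Nws) (s≤s le) with greedy c ws Nws (ℕ.m≤n⇒m≤1+n le)
  ... | s , P with two ws le
    where
      two : ∀ ws → length ws ≤ 2 → ∃[ y₁ ] ∃[ y₂ ] (∀ {v} → v ∈ ws → s v ≡ y₁ ⊎ s v ≡ y₂)
      -- `c u u` is an arbitrary colour that fills the places of missing values.
      two [] _ = c u u , c u u , λ ()
      two (v ∷ []) _ = s v , s v , λ { (here refl) → inj₁ refl }
      two (v ∷ z ∷ []) _ = s v , s z , λ { (here refl) → inj₁ refl ; (there (here refl)) → inj₂ refl }
      two (_ ∷ _ ∷ _ ∷ _) (s≤s (s≤s ()))
  ...   | y₁ , y₂ , values with pick c Nw y₁ y₂
  ...     | t , f , t≢y₁ , t≢y₂ = update s w t , partial-update P f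
              (λ v∈ _ e → [ (λ q → t≢y₁ (trans (≡-sym e) q)) , (λ q → t≢y₂ (trans (≡-sym e) q)) ] (values v∈))

  record Bad (c : Assignment n k) : Set where
    field
      {w₁ w₂ w₃ w₄} : Fin n
      quad : Quad w₁ w₂ w₃ w₄
      x y z : Fin k
    palette : List (Fin k)
    palette = x ∷ y ∷ z ∷ []
    field
      free⇒∈ : ∀ {w t} → N w → Free c w t → t ∈ palette
      ∈⇒free : ∀ {w t} → N w → t ∈ palette → Free c w t

  complete : ∀ {c ws s} → (∀ {w} → N w → w ∈ ws) → PartialSDR c ws s → SDR c s
  complete ∈ws (f , i) = sdr (λ Nw → f (∈ws Nw)) (λ Nw Nw′ → i (∈ws Nw) (∈ws Nw′))

  module Four {c : Assignment n k} {w₁ w₂ w₃ w₄} (Q : Quad w₁ w₂ w₃ w₄) {s : Fin n → Fin k}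
    (P : PartialSDR c (w₁ ∷ w₂ ∷ w₃ ∷ []) s) where

    open Quad Q
    open DecMembership (_≟_ {k}) using (_∈?_)

    three : List (Fin k)
    three = s w₁ ∷ s w₂ ∷ s w₃ ∷ []

    Escape Confined : Fin n → Set
    Escape w = ∃[ t ] (Free c w t × t ∉ three)
    Confined w = ∀ {t} → Free c w t → t ∈ three

    escape : ∀ w → Escape w ⊎ Confined w
    escape w with any? (λ t → free? c w t ×-dec ¬? (t ∈? three))
    ... | yes p = inj₁ p
    ... | no ¬p = inj₂ (λ {t} f → decidable-stable (t ∈? three) (λ t∉ → ¬p (t , f , t∉)))

    value∈ : ∀ {v} → v ∈ w₁ ∷ w₂ ∷ w₃ ∷ [] → s v ∈ three
    value∈ v∈ = ∈-map⁺ s v∈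

    -- At least three colours are free at `w`; confined to three values, they must be all of them.
    all-free : ∀ {w t} → N w → Confined w → t ∈ three → Free c w t
    all-free {w} Nw conf (here refl) with pick c Nw (s w₂) (s w₃)
    ... | t , f , p , q with conf f
    ...   | here refl = f
    ...   | there (here r) = contradiction r p
    ...   | there (there (here r)) = contradiction r q
    all-free {w} Nw conf (there (here refl)) with pick c Nw (s w₁) (s w₃)
    ... | t , f , p , q with conf f
    ...   | here r = contradiction r p
    ...   | there (here refl) = f
    ...   | there (there (here r)) = contradiction r q
    all-free {w} Nw conf (there (there (here refl))) with pick c Nw (s w₁) (s w₂)
    ... | t , f , p , q with conf f
    ...   | here r = contradiction r p
    ...   | there (here r) = contradiction r q
    ...   | there (there (here refl)) = f

    reorder : ∀ {w} → N w → w ∈ w₄ ∷ w₁ ∷ w₂ ∷ w₃ ∷ []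
    reorder Nw with among Q Nw
    ... | is₁ = there (here refl)
    ... | is₂ = there (there (here refl))
    ... | is₃ = there (there (there (here refl)))
    ... | is₄ = here refl

    -- The escaping neighbour `w` moves to the new colour `t` and leaves its old one to `w₄`, where
    -- all three values are free.
    make-room : ∀ {w t} → w ∈ w₁ ∷ w₂ ∷ w₃ ∷ [] → Free c w t → t ∉ three → Confined w₄ → ∃[ s′ ] SDR c s′
    make-room {w} {t} w∈ f t∉ conf = update (update s w t) w₄ (s w) , complete ∈ws′
        (partial-update (partial-update P f (λ v∈ _ e → t∉ (subst (_∈ three) e (value∈ v∈))))
          (all-free n₄ conf (value∈ w∈)) new)
      where
        ∈ws′ : ∀ {v} → N v → v ∈ w₄ ∷ w ∷ w₁ ∷ w₂ ∷ w₃ ∷ []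
        ∈ws′ Nv with reorder Nv
        ... | here p = here p
        ... | there p = there (there p)
        at-w : update s w t w ≢ s w
        at-w e = t∉ (subst (_∈ three) (trans (≡-sym e) (update-at s w t)) (value∈ w∈))
        new : ∀ {v} → v ∈ w ∷ w₁ ∷ w₂ ∷ w₃ ∷ [] → v ≢ w₄ → update s w t v ≢ s w
        new (here refl) _ = at-w
        new {v} (there v∈) _ e = new-other (v ≟ w)
          where
            new-other : Dec (v ≡ w) → ⊥
            new-other (yes refl) = at-w e
            new-other (no v≢w) = v≢w (proj₂ P v∈ w∈ (trans (≡-sym (update-other s t v≢w)) e))

    go : Escape w₄ ⊎ Confined w₄ → Escape w₁ ⊎ Confined w₁ → Escape w₂ ⊎ Confined w₂ →
      Escape w₃ ⊎ Confined w₃ → (∃[ s ] SDR c s) ⊎ Bad c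
    go (inj₁ (t , f , t∉)) _ _ _ = inj₁ (update s w₄ t , complete reorder
      (partial-update P f (λ v∈ _ e → t∉ (subst (_∈ three) e (value∈ v∈)))))
    go (inj₂ c₄) (inj₁ (t , f , t∉)) _ _ = inj₁ (make-room (here refl) f t∉ c₄)
    go (inj₂ c₄) (inj₂ _) (inj₁ (t , f , t∉)) _ = inj₁ (make-room (there (here refl)) f t∉ c₄)
    go (inj₂ c₄) (inj₂ _) (inj₂ _) (inj₁ (t , f , t∉)) = inj₁ (make-room (there (there (here refl))) f t∉ c₄)
    go (inj₂ c₄) (inj₂ c₁) (inj₂ c₂) (inj₂ c₃) = inj₂ (record
      { quad = Q ; x = s w₁ ; y = s w₂ ; z = s w₃
      ; free⇒∈ = λ Nw → confined Nw
      ; ∈⇒free = λ Nw → all-free Nw (confined Nw) })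
      where
        confined : ∀ {w} → N w → Confined w
        confined Nw with among Q Nw
        ... | is₁ = c₁
        ... | is₂ = c₂
        ... | is₃ = c₃
        ... | is₄ = c₄

    sdr-or-bad-four : (∃[ s ] SDR c s) ⊎ Bad c
    sdr-or-bad-four = go (escape w₄) (escape w₁) (escape w₂) (escape w₃)

  sdr-or-bad : ∀ c → (∃[ s ] SDR c s) ⊎ Bad c
  sdr-or-bad c = by-list (neighbours G u) (neighbours-unique G u) (All.tabulate (∈-neighbours⁻ G)) (∈-neighbours G) few
    where
      small : ∀ ws → All N ws → (∀ {w} → N w → w ∈ ws) → length ws ≤ 3 → (∃[ s ] SDR c s) ⊎ Bad c
      small ws Nws ∈ws le with greedy c ws Nws le
      ... | s , P = inj₁ (s , complete ∈ws P)

      by-list : ∀ ws → Unique ws → All N ws → (∀ {w} → N w → w ∈ ws) → length ws ≤ 4 → (∃[ s ] SDR c s) ⊎ Bad c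
      by-list [] U Nws ∈ws le = small [] Nws ∈ws z≤n
      by-list ws@(_ ∷ []) U Nws ∈ws le = small ws Nws ∈ws (s≤s z≤n)
      by-list ws@(_ ∷ _ ∷ []) U Nws ∈ws le = small ws Nws ∈ws (s≤s (s≤s z≤n))
      by-list ws@(_ ∷ _ ∷ _ ∷ []) U Nws ∈ws le = small ws Nws ∈ws (s≤s (s≤s (s≤s z≤n)))
      by-list (w₁ ∷ w₂ ∷ w₃ ∷ w₄ ∷ []) ((p₁₂ ∷ p₁₃ ∷ p₁₄ ∷ []) ∷ (p₂₃ ∷ p₂₄ ∷ []) ∷ (p₃₄ ∷ []) ∷ _) (m₁ ∷ m₂ ∷ m₃ ∷ m₄ ∷ []) ∈ws le =
        Four.sdr-or-bad-four Q (proj₂ (greedy c (w₁ ∷ w₂ ∷ w₃ ∷ []) (m₁ ∷ m₂ ∷ m₃ ∷ []) ℕ.≤-refl))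
        where
          Q : Quad w₁ w₂ w₃ w₄
          Q = record { n₁ = m₁ ; n₂ = m₂ ; n₃ = m₃ ; n₄ = m₄ ; ≢₁₂ = p₁₂ ; ≢₁₃ = p₁₃ ; ≢₁₄ = p₁₄
                     ; ≢₂₃ = p₂₃ ; ≢₂₄ = p₂₄ ; ≢₃₄ = p₃₄ }
      by-list (_ ∷ _ ∷ _ ∷ _ ∷ _ ∷ _) U Nws ∈ws (s≤s (s≤s (s≤s (s≤s ()))))

  bad-no-sdr : ∀ {c s} → Bad c → ¬ SDR c s
  bad-no-sdr {c} {s} B R = ℕ.<⇒≱ (ℕ.n<1+n 3) (unique-subset-length distinct ⊆)
    where
      open Bad B
      open Quad quad
      distinct : Unique (s w₁ ∷ s w₂ ∷ s w₃ ∷ s w₄ ∷ [])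
      distinct = ((≢₁₂ ∘ inj R n₁ n₂) ∷ (≢₁₃ ∘ inj R n₁ n₃) ∷ (≢₁₄ ∘ inj R n₁ n₄) ∷ []) ∷
        ((≢₂₃ ∘ inj R n₂ n₃) ∷ (≢₂₄ ∘ inj R n₂ n₄) ∷ []) ∷ ((≢₃₄ ∘ inj R n₃ n₄) ∷ []) ∷ [] ∷ []
      ⊆ : ∀ {t} → t ∈ s w₁ ∷ s w₂ ∷ s w₃ ∷ s w₄ ∷ [] → t ∈ palette
      ⊆ (here refl) = free⇒∈ n₁ (free R n₁)
      ⊆ (there (here refl)) = free⇒∈ n₂ (free R n₂)
      ⊆ (there (there (here refl))) = free⇒∈ n₃ (free R n₃)
      ⊆ (there (there (there (here refl)))) = free⇒∈ n₄ (free R n₄)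

  -- Exits from colourings that do not extend

  palette-pick : ∀ {c} (B : Bad c) y₁ y₂ → ∃[ i ] (i ∈ Bad.palette B × i ≢ y₁ × i ≢ y₂)
  palette-pick {c} B y₁ y₂ with pick c (Quad.n₁ (Bad.quad B)) y₁ y₂
  ... | i , f , p , q = i , Bad.free⇒∈ B (Quad.n₁ (Bad.quad B)) f , p , q

  -- The four neighbours of `u` force six colours, and three palette colours with two forbidden ones
  -- are only five.
  off-palette-pick : ∀ {c} (B : Bad c) y₁ y₂ → ∃[ j ] (j ∉ Bad.palette B × j ≢ y₁ × j ≢ y₂)
  off-palette-pick B y₁ y₂ with absent-colour (y₁ ∷ y₂ ∷ palette) six
    where
      open Bad B
      open Quad quad
      ⊆ : ∀ {w} → w ∈ w₁ ∷ w₂ ∷ w₃ ∷ w₄ ∷ [] → w ∈ neighbours G u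
      ⊆ (here refl) = ∈-neighbours G n₁
      ⊆ (there (here refl)) = ∈-neighbours G n₂
      ⊆ (there (there (here refl))) = ∈-neighbours G n₃
      ⊆ (there (there (there (here refl)))) = ∈-neighbours G n₄
      six : 6 ≤ k
      six = ℕ.≤-trans (ℕ.+-monoˡ-≤ 2 (unique-subset-length (quad-unique quad) ⊆)) (room u)
  ... | j , j∉ = j , j∉ ∘ there ∘ there , j∉ ∘ here , j∉ ∘ there ∘ here

  -- In a bad colouring every neighbour of `u` has the same free colours. This criterion is easy to
  -- carry through interchanges in colours other than `t`.
  uneven-sdr : ∀ {c w w′ t} → N w → N w′ → Free c w t → ¬ Free c w′ t → ∃[ s ] SDR c s
  uneven-sdr {c} Nw Nw′ f nf with sdr-or-bad c
  ... | inj₁ p = p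
  ... | inj₂ B = contradiction (Bad.∈⇒free B Nw′ (Bad.free⇒∈ B Nw f)) nf

  -- Interchanging i and j on side makes a bad c extendable, since i is free and j is not
  -- free at all neighbours of u.
  record Exit (c : Assignment n k) (i j : Fin k) : Set where
    field
      side : Fin n → Bool
      side-closed : Closed H c i j side
      {inner outer} : Fin n
      n-inner : N inner
      n-outer : N outer
      inside  : side inner ≡ true
      outside : side outer ≡ false
      i-free : Free c inner i
      j-not-free : ¬ Free c outer j

    after : Assignment n k
    after = interchange side i j c

    j-free-after : Free after inner j
    j-free-after v e p = i-free v e (swap-injective i j
      (trans (≡-sym (interchange-in side i j c v inside)) (trans p (≡-sym (swap-first i j)))))

    j-not-free-after : ¬ Free after outer j
    j-not-free-after f = j-not-free (λ v e p → f v e (trans (interchange-out side i j c v outside) p))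

  exit-sdr : ∀ {c i j} (X : Exit c i j) → ∃[ s ] SDR (Exit.after X) s
  exit-sdr X = uneven-sdr n-inner n-outer j-free-after j-not-free-after
    where open Exit X

  -- At each neighbour of `u` the colour `i` is free, so at most one edge there has colour `i` or
  -- `j` and the neighbour is an end in the (i,j)-subgraph. A component has at most two ends, so
  -- that of `w₁` misses `w₂` or `w₃`.
  make-exit : ∀ {c i j} (B : Bad c) → IsEdgeColouring H k c → i ∈ Bad.palette B → j ∉ Bad.palette B → Exit c i j
  make-exit {c} {i} {j} B C i∈ j∉ = choose (comp w₁ w₂) refl (comp w₁ w₃) refl
    where
      open Bad B
      open Quad quad
      open Component {G = H} C i j
      open Ends {G = H} C i j using (IsEnd; two-ends)
      end : ∀ {w} → N w → IsEnd w
      end {w} Nw y z (e , o) (f , o′) =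
        decidable-stable (y ≟ z) (λ y≢z → proper C w y z e f y≢z (trans (is-j e o) (≡-sym (is-j f o′))))
        where
          is-j : ∀ {v} → Adj H w v → OneOf i j (c w v) → c w v ≡ j
          is-j e (inj₁ p) = contradiction p (∈⇒free Nw i∈ _ e)
          is-j e (inj₂ p) = p
      exit-to : ∀ {w} → N w → comp w₁ w ≡ false → Exit c i j
      exit-to Nw out = record
        { side = comp w₁ ; side-closed = comp-closed w₁ ; n-inner = n₁ ; n-outer = Nw
        ; inside = comp-true ε ; outside = out
        ; i-free = ∈⇒free n₁ i∈ ; j-not-free = j∉ ∘ free⇒∈ Nw }
      choose : ∀ β → comp w₁ w₂ ≡ β → ∀ γ → comp w₁ w₃ ≡ γ → Exit c i j
      choose false p _ _ = exit-to n₂ p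
      choose true _ false q = exit-to n₃ q
      choose true p true q = contradiction
        (two-ends (end n₁) (end n₂) (end n₃) ≢₁₂ ≢₁₃ (comp-sound p) (comp-sound q)) ≢₂₃

  module _ {c a b S i j} (C : IsEdgeColouring H k c) (cl : Closed H c a b S) (X : Exit c i j)
    (i≢a : i ≢ a) (i≢b : i ≢ b) (j≢a : j ≢ a) (j≢b : j ≢ b) where

    open Exit X

    -- After the exit, `j` is free at `inner` and not at `outer`, and the interchange of `a` and `b`
    -- preserves this. So both colourings extend and `transfer` applies; the order of the two
    -- interchanges is immaterial.
    exit-commutes : ∀ {s} → SDR after s →
      ∃[ t ] (SDR (interchange side i j (interchange S a b c)) t ×
        G ⊢ join after s ~ join (interchange side i j (interchange S a b c)) t)
    exit-commutes R with uneven-sdr {c = interchange S a b after} n-inner n-outer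
        (free-interchange⁺ S after j≢a j≢b j-free-after) (j-not-free-after ∘ free-interchange⁻ S after j≢a j≢b)
    ... | t , T = t , sdr-resp agrees T ,
        ~-trans (transfer (interchange-colouring side-closed C)
                  (interchange-closed-disjoint side i≢a i≢b j≢a j≢b cl) R T)
          (agree (join-resp agrees (λ _ → refl)))
      where
        agrees : Agree H (interchange S a b after) (interchange side i j (interchange S a b c))
        agrees x y _ = interchange-interchange S side i≢a i≢b j≢a j≢b c x y

    exit-closed : Closed H (interchange S a b c) i j side
    exit-closed = interchange-closed-disjoint S (≢-sym i≢a) (≢-sym j≢a) (≢-sym i≢b) (≢-sym j≢b) side-closed

    -- In the square formed by the two interchanges, the corner opposite to `c` extends. It links
    -- the two other corners, so the path never has to pass through an extension of `c`.
    exit-same : ∀ {s s′} → SDR after s → SDR (interchange S a b c) s′ →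
      G ⊢ join after s ~ join (interchange S a b c) s′
    exit-same R R′ with exit-commutes R
    ... | t , T , p = ~-trans p (~-sym (transfer (interchange-colouring cl C) exit-closed R′ T))

    exit-after : Exit (interchange S a b c) i j
    exit-after = record
      { side = side ; side-closed = exit-closed ; n-inner = n-inner ; n-outer = n-outer
      ; inside = inside ; outside = outside
      ; i-free = free-interchange⁺ S c i≢a i≢b i-free
      ; j-not-free = j-not-free ∘ free-interchange⁻ S c j≢a j≢b }

  -- Following a sequence of switches of `G − u`

  record Way (κ c : Assignment n k) (B : Bad c) (i j : Fin k) : Set where
    constructor way
    field
      on-palette  : i ∈ Bad.palette B
      off-palette : j ∉ Bad.palette B
      exit : Exit c i j
      {assignment} : Fin n → Fin k
      way-sdr : SDR (Exit.after exit) assignment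
      leads : G ⊢ join (Exit.after exit) assignment ~ κ

  ways-disjoint : ∀ {κ c i j i′ j′} {B : Bad c} → IsEdgeColouring H k c → Way κ c B i j →
    i′ ∈ Bad.palette B → j′ ∉ Bad.palette B → i′ ≢ i → j′ ≢ j → Way κ c B i′ j′
  ways-disjoint {B = B} C (way i∈ j∉ X R p) i′∈ j′∉ i′≢i j′≢j = way i′∈ j′∉ X′ R′
      (~-trans (exit-same C (Exit.side-closed X) X′ i′≢i (λ { refl → j∉ i′∈ }) (λ { refl → j′∉ i∈ }) j′≢j R′ R) p)
    where
      X′ = make-exit B C i′∈ j′∉
      R′ = proj₂ (exit-sdr X′)

  -- `ways-disjoint` replaces both colours at once. A detour through `p` outside `i`, `i′` and `q`
  -- outside `j`, `j′` also covers pairs that share a colour.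
  ways : ∀ {κ c i j i′ j′} {B : Bad c} → IsEdgeColouring H k c → Way κ c B i j →
    i′ ∈ Bad.palette B → j′ ∉ Bad.palette B → Way κ c B i′ j′
  ways {i = i} {j} {i′} {j′} {B} C W i′∈ j′∉ with palette-pick B i i′ | off-palette-pick B j j′
  ... | _ , p , p≢i , p≢i′ | _ , q , q≢j , q≢j′ =
    ways-disjoint C (ways-disjoint C W p q p≢i q≢j) i′∈ j′∉ (≢-sym p≢i′) (≢-sym q≢j′)

  -- All extensions of c or, when there are none, all exits from c lie in the class of κ.
  data InClass (κ c : Assignment n k) : Set where
    good : ∀ {s} → SDR c s → G ⊢ join c s ~ κ → InClass κ c
    bad  : ∀ {i j} (B : Bad c) → Way κ c B i j → InClass κ c

  -- Whenever one of the two colourings is bad, it has an exit in colours distinct from `a` and `b`,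
  -- and that exit commutes with the switch. A switch from a good to a bad colouring is handled by
  -- reading it backwards.
  inClass-switch : ∀ {κ c a b S} → IsEdgeColouring H k c → Closed H c a b S →
    InClass κ c → InClass κ (interchange S a b c)
  inClass-switch {κ} {c} {a} {b} {S} C cl I = go I (sdr-or-bad c′)
    where
      c′ : Assignment n k
      c′ = interchange S a b c
      C′ : IsEdgeColouring H k c′
      C′ = interchange-colouring cl C
      back : Agree H (interchange S a b c′) c
      back x y _ = interchange-involutive S a b c x y

      enter : ∀ {s i j} → SDR c s → G ⊢ join c s ~ κ → (B : Bad c′) →
        i ∈ Bad.palette B × i ≢ a × i ≢ b → j ∉ Bad.palette B × j ≢ a × j ≢ b → InClass κ c′
      enter {s} R p B (i∈ , i≢a , i≢b) (j∉ , j≢a , j≢b) = bad B (way i∈ j∉ X R′ (~-trans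
          (exit-same C′ (interchange-closed S cl) X i≢a i≢b j≢a j≢b R′ (sdr-resp (agree-sym H back) R))
          (~-trans (agree (join-resp {t = s} back (λ _ → refl))) p)))
        where
          X = make-exit B C′ i∈ j∉
          R′ = proj₂ (exit-sdr X)

      leave : ∀ {i j} {B : Bad c} → Way κ c B i j → i ≢ a → i ≢ b → j ≢ a → j ≢ b →
        (∃[ s ] SDR c′ s) ⊎ Bad c′ → InClass κ c′
      leave (way _ _ X R p) i≢a i≢b j≢a j≢b (inj₁ (_ , R′)) =
        good R′ (~-trans (~-sym (exit-same C cl X i≢a i≢b j≢a j≢b R R′)) p)
      leave (way _ _ X R p) i≢a i≢b j≢a j≢b (inj₂ B′) = continue (exit-commutes C cl X i≢a i≢b j≢a j≢b R)
        where
          open Exit X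
          continue : ∃[ t ] (SDR (interchange side _ _ c′) t × G ⊢ join after _ ~ join (interchange side _ _ c′) t) →
            InClass κ c′
          -- The two freeness witnesses of the exit survive the switch; as `c′` is bad, they place
          -- one colour on its palette and the other off it.
          continue (t , T , q) = bad B′ (way
            (Bad.free⇒∈ B′ n-inner (free-interchange⁺ S c i≢a i≢b i-free))
            (λ j∈ → j-not-free (free-interchange⁻ S c j≢a j≢b (Bad.∈⇒free B′ n-outer j∈)))
            (exit-after C cl X i≢a i≢b j≢a j≢b) T (~-trans (~-sym q) p))

      go : InClass κ c → (∃[ s ] SDR c′ s) ⊎ Bad c′ → InClass κ c′
      go (good R p) (inj₁ (_ , R′)) = good R′ (~-trans (~-sym (transfer C cl R R′)) p)
      go (good R p) (inj₂ B) =
        enter R p B (proj₂ (palette-pick B a b)) (proj₂ (off-palette-pick B a b))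
      go (bad B W) next = go-on (palette-pick B a b) (off-palette-pick B a b)
        where
          go-on : ∃[ i ] (i ∈ Bad.palette B × i ≢ a × i ≢ b) → ∃[ j ] (j ∉ Bad.palette B × j ≢ a × j ≢ b) →
            InClass κ c′
          go-on (i , i∈ , i≢a , i≢b) (j , j∉ , j≢a , j≢b) = leave (ways C W i∈ j∉) i≢a i≢b j≢a j≢b next

  inClass-end : ∀ {κ c d s} → IsEdgeColouring H k c → H ⊢ c ~ d → InClass κ c → SDR d s → G ⊢ κ ~ join d s
  inClass-end C (agree p) (good R q) R′ =
    ~-trans (~-sym q) (~-trans (agree (join-resp p (λ _ → refl)))
      (unique-extension (colouring-resp H p C) (sdr-resp p R) R′))
  inClass-end C (agree p) (bad B _) R′ = contradiction (sdr-resp (agree-sym H p) R′) (bad-no-sdr B)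
  inClass-end C (switch cl p) I R′ = inClass-end (interchange-colouring cl C) p (inClass-switch C cl I) R′

  extend-~ : ∀ {c d} → IsEdgeColouring G k c → IsEdgeColouring G k d → H ⊢ c ~ d → G ⊢ c ~ d
  extend-~ C D p = ~-trans (agree (star-join C (λ _ _ _ → refl)))
    (~-trans (inClass-end (isolate-colouring G u C) p (good (star-sdr C (λ _ _ _ → refl)) (agree (λ _ _ _ → refl)))
        (star-sdr D (λ _ _ _ → refl)))
      (~-sym (agree (star-join D (λ _ _ _ → refl)))))

-- Induction over the vertices and the degree bound

all-connected : (G : Graph n) (vs : List (Fin n)) → (∀ {x y} → Adj G x y → x ∈ vs) →
  (∀ w → length (neighbours G w) ≤ 4) → (∀ w → length (neighbours G w) + 2 ≤ k) →
  {c d : Assignment n k} → IsEdgeColouring G k c → IsEdgeColouring G k d → G ⊢ c ~ d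
all-connected G [] ∈vs few room C D = agree (λ x y e → contradiction (∈vs e) λ ())
all-connected G (u ∷ vs) ∈vs few room C D =
  -- The number `k` of colours stays fixed while degrees fall. This is why the bounds are stated for
  -- each vertex, and not as an equality between `k` and Δ + 2.
  AtVertex.extend-~ G u (few u) room C D
    (all-connected (isolate G u) vs ∈vs′ (λ w → ℕ.≤-trans (fewer w) (few w))
      (λ w → ℕ.≤-trans (ℕ.+-monoˡ-≤ 2 (fewer w)) (room w))
      (isolate-colouring G u C) (isolate-colouring G u D))
  where
    fewer : ∀ w → length (neighbours (isolate G u) w) ≤ length (neighbours G w)
    fewer w = unique-subset-length (neighbours-unique (isolate G u) w)
      (λ v∈ → ∈-neighbours G (proj₁ (isolate-adj⁻ G u (∈-neighbours⁻ (isolate G u) v∈))))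
    ∈vs′ : ∀ {x y} → Adj (isolate G u) x y → x ∈ vs
    ∈vs′ e with isolate-adj⁻ G u e
    ... | e′ , x≢u , _ with ∈vs e′
    ...   | here x≡u = contradiction x≡u x≢u
    ...   | there x∈ = x∈

degree≡length : (G : Graph n) (w : Fin n) → degree G w ≡ length (neighbours G w)
degree≡length {n} G w = count (allFin n)
  where
    count : ∀ vs → sum (map (λ v → if adj G w v then 1 else 0) vs) ≡ length (filter (adj? G w) vs)
    count [] = refl
    count (v ∷ vs) with adj G w v
    ... | true = cong suc (count vs)
    ... | false = count vs

degree≤maxDegree : (G : Graph n) (w : Fin n) → degree G w ≤ maxDegree G
degree≤maxDegree {n} G w = bound (allFin n) (∈-allFin w)
  where
    bound : ∀ vs → w ∈ vs → degree G w ≤ foldr _⊔_ 0 (map (degree G) vs)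
    bound (v ∷ vs) (here refl) = ℕ.m≤m⊔n (degree G w) _
    bound (v ∷ vs) (there w∈) = ℕ.≤-trans (bound vs w∈) (ℕ.m≤n⊔m (degree G v) _)

theorem2 : ∀ (n : ℕ) (G : Graph n) → maxDegree G ≤ 4 →
    ∀ (c c′ : Assignment n (maxDegree G + 2)) →
    IsEdgeColouring G (maxDegree G + 2) c → IsEdgeColouring G (maxDegree G + 2) c′ →
    KempeEquivalent G c c′
theorem2 n G Δ≤4 c c′ C C′ = identity , ~⇒kempe C
  (all-connected G (allFin n) (λ {x} _ → ∈-allFin x)
    (λ w → ℕ.≤-trans (bound w) Δ≤4) (λ w → ℕ.+-monoˡ-≤ 2 (bound w)) C C′)
  where
    bound : ∀ w → length (neighbours G w) ≤ maxDegree G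
    bound w = subst (_≤ maxDegree G) (degree≡length G w) (degree≤maxDegree G w)
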